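{- For every $A\in\mathcal A$, the predominated graph $(A,V(A)\setminus X(A))$ is an atomic MBD critical graph.
   Context: For a tree $T$, $S(T)$ is obtained by subdividing each edge of $T$ exactly once; $\mathcal S=\{S(T):T\text{ a tree}\}$ and $X(S(T))=V(T)$ (with $S(P_1)=P_1$, $X(P_1)=V(P_1)$). For an integer $k\ge 2$, the $k$-odd replacement of an edge $xy$ of a graph removes $xy$ and adds $k$ internally vertex-disjoint $x,y$-paths of arbitrary odd lengths. $\mathcal A$ is the smallest family of graphs such that (i) $\mathcal S\subseteq\mathcal A$ (with the given $X$), and (ii) if $A\in\mathcal A$ and $A'$ is obtained from $A$ by a $k$-odd replacement ($k\ge2$) of an edge of $A$, then $A'\in\mathcal A$, with $X(A')$ the bipartition class of the bipartite graph $A'$ containing $X(A)$. A predominated graph is a pair $(G,D)$ with $D\subseteq V(G)$; in the MBD game on $(G,D)$, Staller and Dominator alternately claim unclaimed vertices of $V(G)$ (including those of $D$), Staller first; Staller wins if she claims all of $N_G[v]$ for some $v\in V(G)\setminus D$, Dominator wins otherwise. $(G,D)$ is MBD critical if Staller wins on $(G,D)$ but Dominator wins on $(G,D\cup\{v\})$ for every $v\in V(G)\setminus D$; it is atomic MBD critical if additionally $D$ is independent in $G$ and no vertex of $D$ is isolated in $G$. -}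

module Defs where

open import Data.Bool.Base using (Bool; T; true; false; not)
open import Data.Bool.Properties using (not-involutive)
open import Data.Empty using (⊥)
open import Data.Fin.Base using (Fin; zero; suc; toℕ; fromℕ; inject₁) renaming (_<_ to _<ᶠ_)
open import Data.Fin.Subset using (Subset; _∈_; _∉_; _∪_; ⁅_⁆)
open import Data.Maybe.Base using (Maybe; just; nothing)
open import Data.Nat.Base using (ℕ; zero; suc; _+_; _*_; _≤_; NonZero)
open import Data.Nat.Properties using (+-suc)
open import Data.Product.Base using (Σ; ∃; _×_; _,_; proj₁; proj₂; Σ-syntax; ∃-syntax)
open import Data.Sum.Base using (_⊎_; inj₁; inj₂)
open import Data.Vec.Base using (Vec; lookup; replicate; tabulate; _[_]≔_)
open import Data.Vec.Properties using (lookup⇒[]=; []=⇒lookup; lookup∘tabulate)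
open import Function.Bundles using (_⇔_; _↔_; Inverse; Equivalence)
open import Function.Definitions using (Injective)
open import Relation.Binary.Construct.Closure.ReflexiveTransitive using (Star)
open import Relation.Binary.PropositionalEquality using (_≡_; refl; sym; trans; cong; module ≡-Reasoning)
open import Relation.Nullary.Negation.Core using (¬_; contradiction)

------------------------------------------------------------------------
-- Finite simple graphs

record Graph : Set where
  field
    order      : ℕ
    adj        : Fin order → Fin order → Bool
    adj-sym    : ∀ u v → adj u v ≡ adj v u
    adj-irrefl : ∀ v → adj v v ≡ false

  V : Set
  V = Fin order

  Adj : V → V → Set
  Adj u v = T (adj u v)

  -- Each undirected edge {u , v} is represented once, with u < v.
  Edge : Set
  Edge = Σ[ e ∈ V × V ] (proj₁ e <ᶠ proj₂ e × Adj (proj₁ e) (proj₂ e))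

  _∈N[_] : V → V → Set
  u ∈N[ v ] = u ≡ v ⊎ Adj v u

  Isolated : V → Set
  Isolated v = ∀ u → ¬ Adj v u

  Independent : Subset order → Set
  Independent D = ∀ {u v} → u ∈ D → v ∈ D → ¬ Adj u v

  IsBipartitionClass : Subset order → Set
  IsBipartitionClass X =
    ∀ {u v} → Adj u v → (u ∈ X × v ∉ X) ⊎ (u ∉ X × v ∈ X)

  Connected : Set
  Connected = ∀ u v → Star Adj u v

  -- A cycle c 0 , c 1 , … , c (2 + m) , c 0 on 3 + m distinct vertices.
  record Cycle : Set where
    field
      m         : ℕ
      c         : Fin (3 + m) → V
      injective : Injective _≡_ _≡_ c
      step      : ∀ (i : Fin (2 + m)) → Adj (c (inject₁ i)) (c (suc i))
      close     : Adj (c (fromℕ (2 + m))) (c zero)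

  record IsTree : Set where
    field
      nonempty  : NonZero order
      connected : Connected
      acyclic   : ¬ Cycle

open Graph public using (order; V; Adj; Edge; IsTree; IsBipartitionClass)

-- G is, up to renaming its vertices, the graph on W with adjacency _~_.
record Realises (G : Graph) {W : Set} (_~_ : W → W → Set) : Set where
  field
    bijection : V G ↔ W
  open Inverse bijection public using (to; from)
  field
    adjacency : ∀ a b → Adj G a b ⇔ (to a ~ to b)

------------------------------------------------------------------------
-- Subdividing every edge exactly once

module _ (G : Graph) where

  SubdivisionVertex : Set
  SubdivisionVertex = V G ⊎ Edge G

  Endpoint : V G → Edge G → Set
  Endpoint w ((u , v) , _) = w ≡ u ⊎ w ≡ v

  SubdivisionAdj : SubdivisionVertex → SubdivisionVertex → Set
  SubdivisionAdj (inj₁ w) (inj₂ e) = Endpoint w e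
  SubdivisionAdj (inj₂ e) (inj₁ w) = Endpoint w e
  SubdivisionAdj (inj₁ _) (inj₁ _) = ⊥
  SubdivisionAdj (inj₂ _) (inj₂ _) = ⊥

record SubdividedTree (G : Graph) (X : Subset (order G)) : Set where
  field
    tree     : Graph
    isTree   : IsTree tree
    realises : Realises G (SubdivisionAdj tree)
  open Realises realises
  field
    X-is-V-tree : ∀ a → a ∈ X ⇔ (∃[ w ] to a ≡ inj₁ w)

------------------------------------------------------------------------
-- k-odd replacement of the edge xy; the i-th new path has length
-- 1 + 2 * h i, hence 2 * h i internal vertices.

module _ (G : Graph) (x y : V G) {k : ℕ} (h : Fin k → ℕ) where

  ReplacementVertex : Set
  ReplacementVertex = V G ⊎ (Σ[ i ∈ Fin k ] Fin (2 * h i))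

  -- At i p a : the vertex a is at distance p from x along the i-th path.
  data At (i : Fin k) : ℕ → ReplacementVertex → Set where
    start : At i 0 (inj₁ x)
    inner : (j : Fin (2 * h i)) → At i (suc (toℕ j)) (inj₂ (i , j))
    end   : At i (suc (2 * h i)) (inj₁ y)

  -- Paths of length 1 (h i ≡ 0) all coincide with the single edge xy.
  -- Choosing several of them is not excluded: it gives the same graph as
  -- choosing just one, so the family 𝒜 below is unaffected.
  data ReplacementAdj : ReplacementVertex → ReplacementVertex → Set where
    kept     : ∀ {u v} → Adj G u v →
               ¬ (u ≡ x × v ≡ y) → ¬ (u ≡ y × v ≡ x) →
               ReplacementAdj (inj₁ u) (inj₁ v)
    forward  : ∀ {i p a b} → At i p a → At i (suc p) b → ReplacementAdj a b
    backward : ∀ {i p a b} → At i p a → At i (suc p) b → ReplacementAdj b a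

record OddReplacement (A A′ : Graph) : Set where
  field
    k        : ℕ
    2≤k      : 2 ≤ k
    x y      : V A
    edge     : Adj A x y
    h        : Fin k → ℕ
    realises : Realises A′ (ReplacementAdj A x y h)
  open Realises realises

  old : V A → V A′
  old v = from (inj₁ v)

-- 𝒜 A X : A belongs to the family, with X(A) = X.
data 𝒜 : (A : Graph) → Subset (order A) → Set where
  subdivided : ∀ {A X} → SubdividedTree A X → 𝒜 A X
  replaced   : ∀ {A X A′ X′} → 𝒜 A X →
               (r : OddReplacement A A′) →
               IsBipartitionClass A′ X′ →
               (∀ {v} → v ∈ X → OddReplacement.old r v ∈ X′) →
               𝒜 A′ X′

------------------------------------------------------------------------
-- The bipartition class demanded by `replaced` always exists, so every
-- k-odd replacement of a member of 𝒜 is again a member of 𝒜.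

private
  fromSides : ∀ {n} (X : Subset n) {u v} → lookup X v ≡ not (lookup X u) →
              (u ∈ X × v ∉ X) ⊎ (u ∉ X × v ∈ X)
  fromSides X {u} {v} eq with lookup X u in equ
  ... | true  = inj₁ (lookup⇒[]= u X equ ,
                      λ v∈X → contradiction (trans (sym ([]=⇒lookup v∈X)) eq) λ ())
  ... | false = inj₂ ((λ u∈X → contradiction (trans (sym ([]=⇒lookup u∈X)) equ) λ ()) ,
                      lookup⇒[]= v X eq)

  outside : ∀ {n} (X : Subset n) {v} → v ∉ X → lookup X v ≡ false
  outside X {v} v∉X with lookup X v in eq
  ... | true  = contradiction (lookup⇒[]= v X eq) v∉X
  ... | false = refl

  toSides : ∀ {n} (X : Subset n) {u v} → (u ∈ X × v ∉ X) ⊎ (u ∉ X × v ∈ X) →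
            lookup X v ≡ not (lookup X u)
  toSides X (inj₁ (u∈X , v∉X)) rewrite []=⇒lookup u∈X = outside X v∉X
  toSides X (inj₂ (u∉X , v∈X)) rewrite outside X u∉X = []=⇒lookup v∈X

  flip : ℕ → Bool → Bool
  flip zero    b = b
  flip (suc n) b = not (flip n b)

  flip-double : ∀ m b → flip (2 * m) b ≡ b
  flip-double zero    b = refl
  flip-double (suc m) b rewrite +-suc m (m + 0) =
    trans (not-involutive _) (flip-double m b)

𝒜⇒bipartitionClass : ∀ {A X} → 𝒜 A X → IsBipartitionClass A X
𝒜⇒bipartitionClass (replaced _ _ class _) = class
𝒜⇒bipartitionClass {X = X} (subdivided s) {a} {b} ab =
  split (to a) (to b) refl refl (Equivalence.to (adjacency a b) ab)
  where
  open SubdividedTree s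
  open Realises realises
  isOld : ∀ {c w} → to c ≡ inj₁ w → c ∈ X
  isOld {c} {w} eq = Equivalence.from (X-is-V-tree c) (w , eq)
  isNew : ∀ {c e} → to c ≡ inj₂ e → c ∉ X
  isNew {c} eq c∈X with Equivalence.to (X-is-V-tree c) c∈X
  ... | w , eq′ = contradiction (trans (sym eq) eq′) λ ()
  split : ∀ α β → to a ≡ α → to b ≡ β → SubdivisionAdj tree α β →
          (a ∈ X × b ∉ X) ⊎ (a ∉ X × b ∈ X)
  split (inj₁ _) (inj₂ _) p q _ = inj₁ (isOld p , isNew q)
  split (inj₂ _) (inj₁ _) p q _ = inj₂ (isNew p , isOld q)

bipartitionClass-exists :
  ∀ {A X A′} → 𝒜 A X → (r : OddReplacement A A′) →
  ∃[ X′ ] IsBipartitionClass A′ X′ × (∀ {v} → v ∈ X → OddReplacement.old r v ∈ X′)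
bipartitionClass-exists {A} {X} {A′} A∈𝒜 r = X′ , class , contains
  where
  open OddReplacement r
  open Realises realises
  side : ReplacementVertex A x y h → Bool
  side (inj₁ u)       = lookup X u
  side (inj₂ (i , j)) = flip (suc (toℕ j)) (lookup X x)
  X′ : Subset (order A′)
  X′ = tabulate (λ a → side (to a))
  opposite : ∀ {u v} → Adj A u v → lookup X v ≡ not (lookup X u)
  opposite uv = toSides X (𝒜⇒bipartitionClass A∈𝒜 uv)
  sideAt : ∀ {i p a} → At A x y h i p a → side a ≡ flip p (lookup X x)
  sideAt start     = refl
  sideAt (inner j) = refl
  sideAt {i} end   = trans (opposite edge) (cong not (sym (flip-double (h i) _)))
  next : ∀ {i p a b} → At A x y h i p a → At A x y h i (suc p) b → side b ≡ not (side a)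
  next s t = trans (sideAt t) (cong not (sym (sideAt s)))
  sides : ∀ {a b} → ReplacementAdj A x y h a b → side b ≡ not (side a)
  sides (kept uv _ _)  = opposite uv
  sides (forward s t)  = next s t
  sides (backward s t) = trans (sym (not-involutive _)) (cong not (sym (next s t)))
  class : IsBipartitionClass A′ X′
  class {a} {b} ab = fromSides X′ (begin
    lookup X′ b        ≡⟨ lookup∘tabulate _ b ⟩
    side (to b)        ≡⟨ sides (Equivalence.to (adjacency a b) ab) ⟩
    not (side (to a))  ≡⟨ cong not (lookup∘tabulate _ a) ⟨
    not (lookup X′ a)  ∎)
    where open ≡-Reasoning
  contains : ∀ {v} → v ∈ X → old v ∈ X′
  contains {v} v∈X = lookup⇒[]= (old v) X′
    (trans (lookup∘tabulate _ (old v))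
      (trans (cong side (Inverse.strictlyInverseˡ bijection (inj₁ v))) ([]=⇒lookup v∈X)))

------------------------------------------------------------------------
-- The MBD game on the predominated graph (G , D)

data Player : Set where
  staller dominator : Player

opponent : Player → Player
opponent staller   = dominator
opponent dominator = staller

module Game (G : Graph) (D : Subset (order G)) where
  open Graph G using (_∈N[_])

  -- The owner of each vertex; nothing means unclaimed.
  Position : Set
  Position = Vec (Maybe Player) (order G)

  initial : Position
  initial = replicate (order G) nothing

  Unclaimed : Position → V G → Set
  Unclaimed pos v = lookup pos v ≡ nothing

  claim : Player → V G → Position → Position
  claim p v pos = pos [ v ]≔ just p

  Over : Position → Set
  Over pos = ∀ v → ¬ Unclaimed pos v

  StallerClaimsNeighbourhood : Position → Set
  StallerClaimsNeighbourhood pos =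
    ∃[ v ] v ∉ D × (∀ u → u ∈N[ v ] → lookup pos u ≡ just staller)

  WonBy : Player → Position → Set
  WonBy staller   pos = StallerClaimsNeighbourhood pos
  WonBy dominator pos = ¬ StallerClaimsNeighbourhood pos

  -- p has a winning strategy from pos when p, respectively p's opponent,
  -- is the next to move.  Play continues until every vertex is claimed.
  mutual
    data WinsMoving (p : Player) (pos : Position) : Set where
      over : Over pos → WonBy p pos → WinsMoving p pos
      move : ∀ v → Unclaimed pos v →
             WinsReplying p (claim p v pos) → WinsMoving p pos

    data WinsReplying (p : Player) (pos : Position) : Set where
      over  : Over pos → WonBy p pos → WinsReplying p pos
      reply : ∃ (Unclaimed pos) →
              (∀ v → Unclaimed pos v → WinsMoving p (claim (opponent p) v pos)) →
              WinsReplying p pos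

  StallerWins : Set
  StallerWins = WinsMoving staller initial

  DominatorWins : Set
  DominatorWins = WinsReplying dominator initial

open Game public using (StallerWins; DominatorWins)

record MBDCritical (G : Graph) (D : Subset (order G)) : Set where
  field
    stallerWins   : StallerWins G D
    dominatorWins : ∀ v → v ∉ D → DominatorWins G (D ∪ ⁅ v ⁆)

record AtomicMBDCritical (G : Graph) (D : Subset (order G)) : Set where
  field
    critical    : MBDCritical G D
    independent : Graph.Independent G D
    noIsolated  : ∀ v → v ∈ D → ¬ Graph.Isolated G v

{-# OPTIONS --safe #-}

-- Let Y = V(A) \ X(A).  Two invariants of the family give the two outcomes.
--
-- For every v in X(A) there is a matching of X(A) \ {v} into Y; once v is
-- predominated, Dominator wins by pairing.  Replacing xy with x in X(A), the
-- matching is extended to each new path by matching the vertices of X before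
-- some threshold towards y and those after it towards x.
--
-- There is a binary tree with leaves in X(A) such that every neighbour of a
-- leaf is one of its ancestors.  Staller claims the root and descends into
-- the subtree that Dominator did not touch, until she owns N[x] for a leaf x.
-- For S(T), remove a vertex u of degree at most one from T and put its edge
-- above the leaf u and the tree of T - u.  A replacement of xy turns the leaf
-- x, which has y as an ancestor, into a caterpillar through the new paths.

module Submission where

open import Defs
import Data.Bool.Base as Bool
open import Data.Bool.Properties using (T?; T-irrelevant)
open import Data.Empty using (⊥)
open import Data.Fin.Base using (Fin; zero; suc; toℕ; fromℕ<; opposite) renaming (_<_ to _<ᶠ_)
open import Data.Fin.Properties using (_≟_; any?; all?; <-cmp; toℕ-injective; toℕ<n; toℕ-inject₁; toℕ-fromℕ; toℕ-fromℕ<; pigeonhole; opposite-prop; opposite-involutive) renaming (<-irrelevant to <ᶠ-irrelevant)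
open import Data.Fin.Subset using (Subset; ∁; _∈_; _∉_; _∪_; ⁅_⁆; _-_; ∣_∣; ⊤)
open import Data.Fin.Subset.Properties using (_∈?_; ∈⊤; p─q⊆p; x∈p∧x≢y⇒x∈p-y; x∈p⇒∣p-x∣<∣p∣; x∈p⇒x∉∁p; x∈∁p⇒x∉p; x∉∁p⇒x∈p; x∈p∪q⁺; x∈⁅x⁆)
open import Data.Maybe.Base using (Maybe; just; nothing)
open import Data.Nat.Base using (ℕ; zero; suc; _+_; _*_; _∸_; _≤_; _<_; s≤s; z≤n; s≤s⁻¹; >-nonZero⁻¹)
open import Data.Nat.Induction using (<-wellFounded)
import Data.Nat.Properties as ℕ
open import Data.Product.Base using (∃; ∃₂; _×_; _,_; proj₁; proj₂; ∃-syntax)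
import Data.Product.Properties as Product
open import Data.Sum.Base as Sum using (_⊎_; inj₁; inj₂; [_,_]′)
import Data.Sum.Properties as Sum
import Data.Unit.Base as Unit
open import Data.Vec.Base using (Vec; []; _∷_; lookup; _[_]≔_; _[_]=_; here; there)
open import Data.Vec.Functional using (updateAt)
open import Data.Vec.Functional.Properties using (updateAt-updates; updateAt-minimal)
open import Data.Vec.Properties using ([]=-injective; []=⇒lookup; lookup⇒[]=; []≔-updates; []≔-minimal; lookup-replicate)
open import Function.Base using (_∘_; id; const)
open import Function.Bundles using (_⇔_; mk⇔; mk↔ₛ′; Inverse; Equivalence)
open import Induction.WellFounded using (Acc; acc)
open import Relation.Binary.Construct.Closure.ReflexiveTransitive using (Star; ε; _◅_)
open import Relation.Binary.Definitions using (tri<; tri≈; tri>; DecidableEquality) renaming (Decidable to Decidable₂)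
open import Relation.Binary.PropositionalEquality using (_≡_; _≢_; refl; sym; trans; cong; cong₂; subst; subst₂)
open import Relation.Nullary.Decidable using (Dec; yes; no; _×-dec_; _⊎-dec_; _→-dec_; ¬?; decidable-stable)
open import Relation.Nullary.Negation.Core using (¬_; contradiction)
open import Relation.Unary using (Decidable)

-- Certificates of criticality

module _ {W : Set} (_~_ : W → W → Set) (In : W → Set) where

  -- In is the class X.  Played holds the vertices Staller already owns (the
  -- ancestors), Free unclaimed ones available to the subtree; a reply of
  -- Dominator meets at most one of the disjoint parts L and R.
  data Elimination (Played Free : W → Set) : Set₁ where
    leaf : ∀ {x} → Free x → In x → (∀ {u} → x ~ u → Played u) →
           Elimination Played Free
    node : ∀ {y} {L R : W → Set} → Free y → Decidable L →
           (∀ {a} → L a → Free a × a ≢ y) →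
           (∀ {a} → R a → Free a × a ≢ y) →
           (∀ {a} → L a → ¬ R a) →
           Elimination (λ a → Played a ⊎ a ≡ y) L →
           Elimination (λ a → Played a ⊎ a ≡ y) R →
           Elimination Played Free

  -- A relation rather than a function: a vertex may have several partners, but no partner serves
  -- two vertices, so every choice of partners is an injection.
  record Matching (v : W) : Set₁ where
    field
      Matched      : W → W → Set
      total        : ∀ {u} → In u → u ≢ v → ∃ (Matched u)
      adjacent     : ∀ {u w} → Matched u w → u ~ w
      cofunctional : ∀ {u u′ w} → Matched u w → Matched u′ w → u ≡ u′

  record Certificate : Set₁ where
    field
      bipartite   : ∀ {u v} → u ~ v → (In u × ¬ In v) ⊎ (¬ In u × In v)
      noIsolated  : ∀ {v} → ¬ In v → ∃ (v ~_)
      matching    : ∀ {v} → In v → Matching v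
      elimination : Elimination (λ _ → ⊥) (λ _ → Unit.⊤)

module _ {W : Set} {_~_ : W → W → Set} {In : W → Set} where

  Elimination-mono : ∀ {P P′ F F′ : W → Set} →
    (∀ {a} → P a → P′ a) → (∀ {a} → F a → F′ a) →
    Elimination _~_ In P F → Elimination _~_ In P′ F′
  Elimination-mono p f (leaf Fx x∈ N) = leaf (f Fx) x∈ (p ∘ N)
  Elimination-mono p f (node Fy L? L⊆ R⊆ LR l r) =
    node (f Fy) L? (λ a → f (proj₁ (L⊆ a)) , proj₂ (L⊆ a))
      (λ a → f (proj₁ (R⊆ a)) , proj₂ (R⊆ a)) LR
      (Elimination-mono (Sum.map₁ p) id l) (Elimination-mono (Sum.map₁ p) id r)

  Elimination-free : ∀ {P F : W → Set} → Elimination _~_ In P F → ∃ F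
  Elimination-free (leaf Fx _ _)           = _ , Fx
  Elimination-free (node Fy _ _ _ _ _ _) = _ , Fy

-- Transport of certificates along graph isomorphisms

module _ {G : Graph} {W : Set} {_~_ : W → W → Set} {In : W → Set} {X : Subset (order G)}
         (realises : Realises G _~_)
         (X⇔In : ∀ a → a ∈ X ⇔ In (Realises.to realises a)) where
  open Realises realises

  private
    to∘from : ∀ w → to (from w) ≡ w
    to∘from = Inverse.strictlyInverseˡ bijection

    from∘to : ∀ a → from (to a) ≡ a
    from∘to = Inverse.strictlyInverseʳ bijection

    In⇒∈ : ∀ {w} → In w → from w ∈ X
    In⇒∈ w∈ = Equivalence.from (X⇔In _) (subst In (sym (to∘from _)) w∈)

    ∈⇒In : ∀ {a} → a ∈ X → In (to a)
    ∈⇒In = Equivalence.to (X⇔In _)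

    ~⇒Adj : ∀ {a w} → to a ~ w → Adj G a (from w)
    ~⇒Adj aw = Equivalence.from (adjacency _ _) (subst (_ ~_) (sym (to∘from _)) aw)

    Adj⇒~ : ∀ {w a} → Adj G (from w) a → w ~ to a
    Adj⇒~ wa = subst (_~ _) (to∘from _) (Equivalence.to (adjacency _ _) wa)

    to≢ : ∀ {a w} → to a ≢ w → a ≢ from w
    to≢ ta≢w refl = ta≢w (to∘from _)

    pullElimination : ∀ {P F} → Elimination _~_ In P F →
                      Elimination (Adj G) (_∈ X) (P ∘ to) (F ∘ to)
    pullElimination {F = F} (leaf Fx x∈ N) =
      leaf (subst F (sym (to∘from _)) Fx) (In⇒∈ x∈) (N ∘ Adj⇒~)
    pullElimination {P} {F} (node {y} Fy L? L⊆ R⊆ LR l r) =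
      node (subst F (sym (to∘from _)) Fy) (L? ∘ to)
        (λ a → proj₁ (L⊆ a) , to≢ (proj₂ (L⊆ a)))
        (λ a → proj₁ (R⊆ a) , to≢ (proj₂ (R⊆ a)))
        LR (pull l) (pull r)
      where
      pull : ∀ {Q} → Elimination _~_ In (λ a → P a ⊎ a ≡ y) Q →
             Elimination (Adj G) (_∈ X) (λ a → P (to a) ⊎ a ≡ from y) (Q ∘ to)
      pull e = Elimination-mono
        (Sum.map id (λ eq → trans (sym (from∘to _)) (cong from eq))) id
        (pullElimination e)

  Certificate-realise : Certificate _~_ In → Certificate (Adj G) (_∈ X)
  Certificate-realise C = record
    { bipartite   = λ uv → Sum.map
        (λ (p , q) → subst (_∈ X) (from∘to _) (In⇒∈ p) , q ∘ ∈⇒In)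
        (λ (p , q) → p ∘ ∈⇒In , subst (_∈ X) (from∘to _) (In⇒∈ q))
        (bipartite (Equivalence.to (adjacency _ _) uv))
    ; noIsolated  = λ v∉X →
        let w , vw = noIsolated (v∉X ∘ Equivalence.from (X⇔In _)) in from w , ~⇒Adj vw
    ; matching    = λ {v} v∈X → let open Matching (matching (∈⇒In v∈X)) in record
        { Matched      = λ u w → Matched (to u) (to w)
        ; total        = λ u∈X u≢v →
            let w , uw = total (∈⇒In u∈X) (u≢v ∘ to-injective)
            in from w , subst (Matched _) (sym (to∘from w)) uw
        ; adjacent     = λ uw → Equivalence.from (adjacency _ _) (adjacent uw)
        ; cofunctional = λ p q → to-injective (cofunctional p q)
        }
    ; elimination = pullElimination elimination
    }
    where
    open Certificate C
    to-injective : ∀ {a b} → to a ≡ to b → a ≡ b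
    to-injective eq = trans (sym (from∘to _)) (trans (cong from eq) (from∘to _))

-- Strategies

unclaimedCount : ∀ {n} → Vec (Maybe Player) n → ℕ
unclaimedCount []               = 0
unclaimedCount (nothing ∷ pos)  = suc (unclaimedCount pos)
unclaimedCount (just _  ∷ pos)  = unclaimedCount pos

unclaimedCount-claim : ∀ {n p v} {pos : Vec (Maybe Player) n} → pos [ v ]= nothing →
                       unclaimedCount pos ≡ suc (unclaimedCount (pos [ v ]≔ just p))
unclaimedCount-claim                         here       = refl
unclaimedCount-claim {pos = nothing ∷ pos} (there v∈) = cong suc (unclaimedCount-claim v∈)
unclaimedCount-claim {pos = just _  ∷ pos} (there v∈) = unclaimedCount-claim v∈

module _ (G : Graph) (D : Subset (order G)) where
  open Game G D hiding (StallerWins; DominatorWins)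

  initially-unclaimed : ∀ {v} → initial [ v ]= nothing
  initially-unclaimed {v} = lookup⇒[]= v initial (lookup-replicate v nothing)

  unclaimed? : (pos : Position) → Decidable (λ v → pos [ v ]= nothing)
  unclaimed? pos v with lookup pos v in eq
  ... | nothing = yes (lookup⇒[]= v pos eq)
  ... | just _  = no λ v-free → contradiction (trans (sym eq) ([]=⇒lookup v-free)) λ ()

  claim-keeps-owner : ∀ {pos p q v u} → pos [ v ]= nothing →
                      pos [ u ]= just q → claim p v pos [ u ]= just q
  claim-keeps-owner {pos} {v = v} {u} v-free u-owned = []≔-minimal pos u v
    (λ { refl → contradiction ([]=-injective v-free u-owned) λ () }) u-owned

  claim-keeps-unclaimed : ∀ {pos p v u} → u ≢ v → pos [ u ]= nothing →
                          claim p v pos [ u ]= nothing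
  claim-keeps-unclaimed {pos} {v = v} {u} u≢v = []≔-minimal pos u v u≢v

  claim-owns : ∀ {pos p v} → claim p v pos [ v ]= just p
  claim-owns {pos} {v = v} = []≔-updates pos v

  Answer : Player → (Position → Set) → Position → Set
  Answer p Inv pos = Inv pos ⊎ ∃[ w ] pos [ w ]= nothing × Inv (claim p w pos)

  module _ (p : Player) (Inv : Position → Set)
           (final   : ∀ {pos} → Inv pos → WonBy p pos)
           (respond : ∀ {pos s} → Inv pos → pos [ s ]= nothing →
                      Answer p Inv (claim (opponent p) s pos))
           (extra   : ∀ {pos w} → Inv pos → pos [ w ]= nothing → Inv (claim p w pos)) where

    -- Induction on the number of unclaimed vertices. If the opponent's move leaves the invariant
    -- intact, `p` must still claim something, and `extra` guarantees that an arbitrary claim does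
    -- no harm.
    invariant⇒wins : ∀ {pos} → Inv pos → WinsReplying p pos
    invariant⇒wins inv = play _ inv refl
      where
      play : ∀ n {pos} → Inv pos → unclaimedCount pos ≡ n → WinsReplying p pos
      answer : ∀ n {pos s} → Inv pos → pos [ s ]= nothing → unclaimedCount pos ≡ suc n →
               WinsMoving p (claim (opponent p) s pos)
      continue : ∀ n {pos w} → pos [ w ]= nothing → Inv (claim p w pos) →
                 unclaimedCount pos ≡ n → WinsMoving p pos

      play n {pos} inv eq with any? (unclaimed? pos)
      ... | no none = over (λ v v-free → none (v , lookup⇒[]= v pos v-free)) (final inv)
      play 0 inv eq | yes (v , v-free) =
        contradiction (trans (sym (unclaimedCount-claim {p = p} v-free)) eq) λ ()
      play (suc n) {pos} inv eq | yes (v , v-free) =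
        reply (v , []=⇒lookup v-free) λ s s-free → answer n inv (lookup⇒[]= s pos s-free) eq

      answer n {pos} {s} inv s-free eq = cases (respond inv s-free)
        where
        pos′ : Position
        pos′ = claim (opponent p) s pos
        eq′ : unclaimedCount pos′ ≡ n
        eq′ = ℕ.suc-injective (trans (sym (unclaimedCount-claim s-free)) eq)
        cases : Answer p Inv pos′ → WinsMoving p pos′
        cases (inj₂ (w , w-free , inv′)) = continue n w-free inv′ eq′
        cases (inj₁ inv′) with any? (unclaimed? pos′)
        ... | no  none         =
          over (λ v v-free → none (v , lookup⇒[]= v pos′ v-free)) (final inv′)
        ... | yes (w , w-free) = continue n w-free (extra inv′ w-free) eq′

      continue 0 w-free inv eq =
        contradiction (trans (sym (unclaimedCount-claim {p = p} w-free)) eq) λ ()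
      continue (suc n) {w = w} w-free inv eq = move w ([]=⇒lookup w-free)
        (play n inv (ℕ.suc-injective (trans (sym (unclaimedCount-claim w-free)) eq)))

  Captured : Position → Set
  Captured pos = ∃[ v ] v ∉ D × (∀ {u} → u ≡ v ⊎ Adj G v u → pos [ u ]= just staller)

  -- Owners never change, so the rest of the play may be arbitrary once a closed neighbourhood is
  -- complete.
  captured⇒wins : ∀ {pos} → Captured pos → WinsReplying staller pos
  captured⇒wins =
    invariant⇒wins staller Captured (λ (v , v∉D , all) → v , v∉D , λ _ → []=⇒lookup ∘ all)
      (λ inv s-free → inj₁ (keep inv s-free)) keep
    where
    keep : ∀ {pos p w} → Captured pos → pos [ w ]= nothing → Captured (claim p w pos)
    keep (v , v∉D , all) w-free = v , v∉D , claim-keeps-owner w-free ∘ all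

  elimination⇒wins : ∀ {P F pos} → Elimination (Adj G) (_∉ D) P F →
                     (∀ {u} → P u → pos [ u ]= just staller) →
                     (∀ {u} → F u → pos [ u ]= nothing) → WinsMoving staller pos
  elimination⇒wins {pos = pos} (leaf {x} Fx x∉D N) played free =
    move x ([]=⇒lookup (free Fx)) (captured⇒wins (x , x∉D , claimed))
    where
    claimed : ∀ {u} → u ≡ x ⊎ Adj G x u → claim staller x pos [ u ]= just staller
    claimed (inj₁ refl) = claim-owns
    claimed (inj₂ xu)   = claim-keeps-owner (free Fx) (played (N xu))
  elimination⇒wins {P} {F} {pos} (node {y} {L} {R} Fy L? L⊆ R⊆ LR l r) played free =
    -- Dominator still has a move to make, because the left subtree contains a free vertex.
    move y ([]=⇒lookup (free Fy)) (reply (proj₁ some , []=⇒lookup (free₁ L⊆ (proj₂ some)))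
      λ v → descend v ∘ lookup⇒[]= v pos₁)
    where
    some : ∃ L
    some = Elimination-free l
    pos₁ : Position
    pos₁ = claim staller y pos
    free₁ : ∀ {Q : V G → Set} → (∀ {a} → Q a → F a × a ≢ y) → ∀ {a} → Q a → pos₁ [ a ]= nothing
    free₁ Q⊆ Qa = claim-keeps-unclaimed (proj₂ (Q⊆ Qa)) (free (proj₁ (Q⊆ Qa)))
    played₁ : ∀ {a} → P a ⊎ a ≡ y → pos₁ [ a ]= just staller
    played₁ (inj₁ Pa)   = claim-keeps-owner (free Fy) (played Pa)
    played₁ (inj₂ refl) = claim-owns
    descend : ∀ v → pos₁ [ v ]= nothing → WinsMoving staller (claim dominator v pos₁)
    -- A reply outside `L` leaves the left subtree intact whether or not it meets `R`, so testing
    -- `L` alone is enough.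
    descend v v-free with L? v
    ... | yes Lv = elimination⇒wins r (claim-keeps-owner v-free ∘ played₁)
      (λ Ru → claim-keeps-unclaimed (λ { refl → LR Lv Ru }) (free₁ R⊆ Ru))
    ... | no ¬Lv = elimination⇒wins l (claim-keeps-owner v-free ∘ played₁)
      (λ Lu → claim-keeps-unclaimed (λ { refl → ¬Lv Lu }) (free₁ L⊆ Lu))

  -- Dominator's pairing strategy

  module _ {Pair : V G → V G → Set} (pair? : Decidable₂ Pair)
           (irreflexive : ∀ {a} → ¬ Pair a a)
           (symmetric   : ∀ {a b} → Pair a b → Pair b a)
           (functional  : ∀ {a b c} → Pair a b → Pair a c → b ≡ c)
           (covers      : ∀ {v} → v ∉ D → ∃[ w ] Pair v w × Adj G v w) where

    -- Dominator answers in the pair that Staller has just touched, so every pair is untouched or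
    -- contains a vertex of his. Every closed neighbourhood to be defended contains a pair, hence
    -- Staller never owns all of it.
    pairing⇒wins : DominatorWins G D
    pairing⇒wins = invariant⇒wins dominator Inv final respond extra
      λ _ → inj₂ (inj₂ (initially-unclaimed , initially-unclaimed))
      where
      Safe : Position → V G → V G → Set
      Safe pos a b = pos [ a ]= just dominator ⊎ pos [ b ]= just dominator ⊎
                     (pos [ a ]= nothing × pos [ b ]= nothing)

      Inv : Position → Set
      Inv pos = ∀ {a b} → Pair a b → Safe pos a b

      final : ∀ {pos} → Inv pos → ¬ StallerClaimsNeighbourhood pos
      final inv (v , v∉D , all) with covers v∉D
      ... | w , vw , v~w with all v (inj₁ refl) | all w (inj₂ v~w) | inv vw
      ... | p | q | inj₁ r               = contradiction ([]=-injective (lookup⇒[]= _ _ p) r) λ ()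
      ... | p | q | inj₂ (inj₁ r)        = contradiction ([]=-injective (lookup⇒[]= _ _ q) r) λ ()
      ... | p | q | inj₂ (inj₂ (r , _))  = contradiction ([]=-injective (lookup⇒[]= _ _ p) r) λ ()

      keep : ∀ {pos p w a b} → pos [ w ]= nothing → Safe pos a b →
             a ≡ w ⊎ b ≡ w ⊎ Safe (claim p w pos) a b
      keep w-free (inj₁ r)        = inj₂ (inj₂ (inj₁ (claim-keeps-owner w-free r)))
      keep w-free (inj₂ (inj₁ r)) = inj₂ (inj₂ (inj₂ (inj₁ (claim-keeps-owner w-free r))))
      keep {w = w} {a} {b} w-free (inj₂ (inj₂ (r , s))) with a ≟ w | b ≟ w
      ... | yes a≡w | _       = inj₁ a≡w
      ... | no  _   | yes b≡w = inj₂ (inj₁ b≡w)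
      ... | no  a≢w | no  b≢w = inj₂ (inj₂ (inj₂ (inj₂
        (claim-keeps-unclaimed a≢w r , claim-keeps-unclaimed b≢w s))))

      secure : ∀ {pos w a b} → pos [ w ]= nothing → a ≡ w ⊎ b ≡ w ⊎ Safe pos a b →
               Safe (claim dominator w pos) a b
      secure {pos} w-free (inj₁ refl)        = inj₁ claim-owns
      secure {pos} w-free (inj₂ (inj₁ refl)) = inj₂ (inj₁ claim-owns)
      secure {pos} {w} {a} {b} w-free (inj₂ (inj₂ safe))
        with keep {pos} {dominator} {w} {a} {b} w-free safe
      ... | inj₂ (inj₂ safe′)  = safe′
      ... | inj₁ refl          = inj₁ claim-owns
      ... | inj₂ (inj₁ refl)   = inj₂ (inj₁ claim-owns)

      extra : ∀ {pos w} → Inv pos → pos [ w ]= nothing → Inv (claim dominator w pos)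
      extra inv w-free ab = secure w-free (inj₂ (inj₂ (inv ab)))

      respond : ∀ {pos s} → Inv pos → pos [ s ]= nothing →
                Answer dominator Inv (claim staller s pos)
      respond {pos} {s} inv s-free
        with any? (λ b → pair? s b ×-dec unclaimed? (claim staller s pos) b)
      ... | yes (b , sb , b-free) = inj₂ (b , b-free , inv′)
        where
        inv′ : Inv (claim dominator b (claim staller s pos))
        inv′ {a} {c} ac with keep {pos} {staller} {s} {a} {c} s-free (inv ac)
        ... | inj₁ refl        = secure b-free (inj₂ (inj₁ (functional ac sb)))
        ... | inj₂ (inj₁ refl) = secure b-free (inj₁ (functional (symmetric ac) sb))
        ... | inj₂ (inj₂ safe) = secure b-free (inj₂ (inj₂ safe))
      -- A partner of `s` that is no longer unclaimed is already Dominator's: its pair was safe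
      -- while `s` was unclaimed.
      ... | no none = inj₁ inv′
        where
        partner : ∀ {c} → Pair s c → claim staller s pos [ c ]= just dominator
        partner {c} sc with inv sc
        ... | inj₁ r              = contradiction ([]=-injective s-free r) λ ()
        ... | inj₂ (inj₁ r)       = claim-keeps-owner s-free r
        ... | inj₂ (inj₂ (_ , r)) = contradiction
          (c , sc , claim-keeps-unclaimed (λ { refl → irreflexive sc }) r) none
        inv′ : Inv (claim staller s pos)
        inv′ {a} {c} ac with keep {pos} {staller} {s} {a} {c} s-free (inv ac)
        ... | inj₁ refl        = inj₂ (inj₁ (partner ac))
        ... | inj₂ (inj₁ refl) = inj₁ (partner (symmetric ac))
        ... | inj₂ (inj₂ safe) = safe

-- From certificates to criticality

module _ {A : Graph} {X : Subset (order A)} (C : Certificate (Adj A) (_∈ X)) where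
  open Certificate C

  private
    -- The vertices to be defended are those of `X` other than `v`, and the matching gives each of
    -- them a partner. Partners lie outside `X` by bipartiteness, so no vertex is in two pairs.
    dominatorWins : ∀ v → v ∉ ∁ X → DominatorWins A (∁ X ∪ ⁅ v ⁆)
    dominatorWins v v∉∁X = pairing⇒wins A (∁ X ∪ ⁅ v ⁆) pair? irreflexive Sum.swap functional covers
      where
      open Matching (matching (x∉∁p⇒x∈p v∉∁X))

      Covered : V A → Set
      Covered u = u ∈ X × u ≢ v

      covered? : Decidable Covered
      covered? u = (u ∈? X) ×-dec ¬? (u ≟ v)

      -- m u = u is a junk value when u is not covered.
      m : V A → V A
      m u with covered? u
      ... | yes (u∈X , u≢v) = proj₁ (total u∈X u≢v)
      ... | no  _           = u

      m-matched : ∀ {u} → Covered u → Matched u (m u)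
      m-matched {u} cov with covered? u
      ... | yes (u∈X , u≢v) = proj₂ (total u∈X u≢v)
      ... | no  ¬cov        = contradiction cov ¬cov

      m∉X : ∀ {u} → Covered u → m u ∉ X
      m∉X cov with bipartite (adjacent (m-matched cov))
      ... | inj₁ (_ , m∉)   = m∉
      ... | inj₂ (u∉X , _)  = contradiction (proj₁ cov) u∉X

      Half : V A → V A → Set
      Half a b = Covered a × b ≡ m a

      Pair : V A → V A → Set
      Pair a b = Half a b ⊎ Half b a

      pair? : Decidable₂ Pair
      pair? a b = (covered? a ×-dec (b ≟ m a)) ⊎-dec (covered? b ×-dec (a ≟ m b))

      no-self : ∀ {a} → ¬ Half a a
      no-self (cov , eq) = m∉X cov (subst (_∈ X) eq (proj₁ cov))

      irreflexive : ∀ {a} → ¬ Pair a a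
      irreflexive = [ no-self , no-self ]′

      functional : ∀ {a b c} → Pair a b → Pair a c → b ≡ c
      functional (inj₁ (_ , p)) (inj₁ (_ , q)) = trans p (sym q)
      functional (inj₁ (a , p)) (inj₂ (c , q)) = contradiction (subst (_∈ X) q (proj₁ a)) (m∉X c)
      functional (inj₂ (b , p)) (inj₁ (a , q)) = contradiction (subst (_∈ X) p (proj₁ a)) (m∉X b)
      functional (inj₂ (b , p)) (inj₂ (c , q)) = cofunctional (m-matched b)
        (subst (Matched _) (trans (sym q) p) (m-matched c))

      covers : ∀ {u} → u ∉ ∁ X ∪ ⁅ v ⁆ → ∃[ w ] Pair u w × Adj A u w
      covers {u} u∉ = m u , inj₁ (cov , refl) , adjacent (m-matched cov)
        where
        cov : Covered u
        cov = x∉∁p⇒x∈p (u∉ ∘ x∈p∪q⁺ ∘ inj₁) , λ { refl → u∉ (x∈p∪q⁺ (inj₂ (x∈⁅x⁆ u))) }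

    In⇒∉∁ : ∀ {P F} → Elimination (Adj A) (_∈ X) P F → Elimination (Adj A) (_∉ ∁ X) P F
    In⇒∉∁ (leaf Fx x∈X N)              = leaf Fx (x∈p⇒x∉∁p x∈X) N
    In⇒∉∁ (node Fy L? L⊆ R⊆ LR l r) = node Fy L? L⊆ R⊆ LR (In⇒∉∁ l) (In⇒∉∁ r)

  certificate⇒critical : AtomicMBDCritical A (∁ X)
  certificate⇒critical = record
    { critical    = record
      { stallerWins   = elimination⇒wins A (∁ X) (In⇒∉∁ elimination) (λ ())
                          (λ _ → initially-unclaimed A (∁ X))
      ; dominatorWins = dominatorWins
      }
    ; independent = λ u∈ v∈ uv →
        [ (λ p → x∈∁p⇒x∉p u∈ (proj₁ p)) , (λ p → x∈∁p⇒x∉p v∈ (proj₂ p)) ]′ (bipartite uv)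
    ; noIsolated  = λ v v∈ isolated →
        let w , vw = noIsolated (x∈∁p⇒x∉p v∈) in isolated w vw
    }

-- Subdivided trees

module _ {P : ℕ → Set} (P? : Decidable P) where

  least : ∀ {n} → P n → ∃[ m ] P m × (∀ {j} → j < m → ¬ P j)
  least {n} = search (<-wellFounded n)
    where
    search : ∀ {n} → Acc _<_ n → P n → ∃[ m ] P m × (∀ {j} → j < m → ¬ P j)
    search {n} (acc rs) Pn with ℕ.anyUpTo? P? n
    ... | yes (j , j<n , Pj) = search (rs j<n) Pj
    ... | no  none           = n , Pn , λ j<n Pj → none (_ , j<n , Pj)

x∉p-x : ∀ {n} {p : Subset n} {x} → x ∉ p - x
x∉p-x {p = _ ∷ _} {zero}  ()
x∉p-x {p = _ ∷ _} {suc x} (there x∈) = x∉p-x x∈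

module _ (T : Graph) where
  open Graph T using (adj; adj-sym; adj-irrefl; Cycle; Connected)

  Adj? : ∀ u v → Dec (Adj T u v)
  Adj? u v = T? (adj u v)

  Adj-sym : ∀ {u v} → Adj T u v → Adj T v u
  Adj-sym {u} {v} = subst Bool.T (adj-sym u v)

  Adj-irrefl : ∀ {u} → ¬ Adj T u u
  Adj-irrefl {u} = subst Bool.T (adj-irrefl u)

  -- Endless walks close up to a cycle

  module _ (f : ℕ → V T) (walk : ∀ n → Adj T (f n) (f (suc n)))
           (non-backtracking : ∀ n → f (suc (suc n)) ≢ f n) where

    private
      Repeats : ℕ → Set
      Repeats j = ∃[ i ] i < j × f i ≡ f j

      repeats? : Decidable Repeats
      repeats? j = ℕ.anyUpTo? (λ i → f i ≟ f j) j

      some-repeat : ∃ Repeats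
      some-repeat =
        let i , j , i<j , eq = pigeonhole {n = suc (order T)} ℕ.≤-refl (f ∘ toℕ)
        in toℕ j , toℕ i , i<j , eq

      close-cycle : ∀ i m → f i ≡ f (i + (3 + m)) → (∀ {j} → j < i + (3 + m) → ¬ Repeats j) → Cycle
      close-cycle i m eq fresh = record
        { m         = m
        ; c         = λ t → f (i + toℕ t)
        ; injective = injective
        ; step      = λ t → subst₂ (λ a b → Adj T (f (i + a)) (f b))
                        (sym (toℕ-inject₁ t)) (sym (ℕ.+-suc i (toℕ t))) (walk (i + toℕ t))
        ; close     = subst₂ (Adj T)
                        (cong (λ a → f (i + a)) (sym (toℕ-fromℕ (2 + m))))
                        (trans (cong f (sym (ℕ.+-suc i (2 + m))))
                          (trans (sym eq) (cong f (sym (ℕ.+-identityʳ i)))))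
                        (walk (i + (2 + m)))
        }
        where
        distinct : ∀ {s t : Fin (3 + m)} → s <ᶠ t → f (i + toℕ s) ≢ f (i + toℕ t)
        distinct {s} {t} s<t eq = fresh (ℕ.+-monoʳ-< i (toℕ<n t)) (_ , ℕ.+-monoʳ-< i s<t , eq)
        injective : ∀ {s t} → f (i + toℕ s) ≡ f (i + toℕ t) → s ≡ t
        injective {s} {t} eq with <-cmp s t
        ... | tri< s<t _ _ = contradiction eq (distinct s<t)
        ... | tri≈ _ s≡t _ = s≡t
        ... | tri> _ _ t<s = contradiction (sym eq) (distinct t<s)

    -- Take the first `j` for which `f j` repeats an earlier `f i`. The gap `j - i` is not 1, since
    -- there are no loops, and not 2, since the walk does not turn back; otherwise the vertices from
    -- `f i` on, up to the one before `f j`, are distinct and form a cycle.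
    non-backtracking⇒cycle : Cycle
    non-backtracking⇒cycle with least repeats? (proj₂ some-repeat)
    ... | j , (i , i<j , eq) , fresh with ℕ.m≤n⇒∃[o]m+o≡n i<j
    ... | 0 , refl = contradiction (walk i)
      (Adj-irrefl ∘ subst (Adj T (f i)) (trans (cong (f ∘ suc) (sym (ℕ.+-identityʳ i))) (sym eq)))
    ... | 1 , refl = contradiction
      (trans (cong (f ∘ suc) (sym (ℕ.+-comm i 1))) (sym eq)) (non-backtracking i)
    ... | suc (suc m) , refl = close-cycle i m (trans eq (cong f shift))
      (λ {j} j< → fresh (subst (j <_) (sym shift) j<))
      where
      shift : suc i + suc (suc m) ≡ i + (3 + m)
      shift = sym (ℕ.+-suc i (2 + m))

  module _ (acyclic : ¬ Cycle) (S : Subset (order T)) where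

    -- p is a junk value if u has no neighbour in S.
    AlmostIsolated : V T → V T → Set
    AlmostIsolated u p = ∀ w → w ∈ S → Adj T u w → w ≡ p

    -- If no such `u` existed, a walk in `S` could always be continued to a vertex other than the
    -- one it came from, and this would produce a cycle.
    acyclic⇒almostIsolated : ∀ {r} → r ∈ S → ∃₂ λ u p → u ∈ S × AlmostIsolated u p
    acyclic⇒almostIsolated {r} r∈S
      with any? (λ u → any? (λ p → (u ∈? S) ×-dec
                  all? (λ w → (w ∈? S) →-dec (Adj? u w →-dec (w ≟ p)))))
    ... | yes (u , p , found) = u , p , found
    ... | no none = contradiction
      (non-backtracking⇒cycle (λ n → current (walk n))
        (λ n → proj₁ (proj₂ (proj₂ (next (walk n)))))
        (λ n → proj₂ (proj₂ (proj₂ (next (walk (suc n)))))))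
      acyclic
      where
      State : Set
      State = V T × ∃ (_∈ S)
      current : State → V T
      current (_ , u , _) = u
      next : (s : State) → ∃[ w ] w ∈ S × Adj T (current s) w × w ≢ proj₁ s
      next (p , u , u∈S)
        with any? (λ w → (w ∈? S) ×-dec (Adj? u w ×-dec ¬? (w ≟ p)))
      ... | yes found = found
      ... | no  none′ = contradiction
        (u , p , u∈S , λ w w∈S uw → decidable-stable (w ≟ p) λ w≢p → none′ (w , w∈S , uw , w≢p))
        none
      advance : State → State
      advance s = let w , w∈S , _ = next s in current s , w , w∈S
      walk : ℕ → State
      -- There is no previous vertex at the start; `r` itself is a harmless default, as it is not
      -- its own neighbour.
      walk zero    = r , r , r∈S
      walk (suc n) = advance (walk n)

  -- Distance to a fixed vertex

  module _ (connected : Connected) (v : V T) where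

    private
      Walk : ℕ → V T → Set
      Walk zero    u = u ≡ v
      Walk (suc n) u = ∃[ w ] Adj T u w × Walk n w

      Walk? : ∀ n → Decidable (Walk n)
      Walk? zero    u = u ≟ v
      Walk? (suc n) u = any? (λ w → Adj? u w ×-dec Walk? n w)

      reach : ∀ {u} → Star (Adj T) u v → ∃[ n ] Walk n u
      reach ε        = 0 , refl
      reach (uw ◅ s) = let n , p = reach s in suc n , _ , uw , p

      shortest : ∀ u → ∃[ m ] Walk m u × (∀ {j} → j < m → ¬ Walk j u)
      shortest u = least (λ n → Walk? n u) (proj₂ (reach (connected u v)))

    distance : V T → ℕ
    distance u = proj₁ (shortest u)

    -- The second vertex of a shortest walk from `u` to `v` has a walk to `v` that is one step
    -- shorter.
    closer : ∀ {u} → u ≢ v → ∃[ w ] Adj T u w × distance w < distance u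
    closer {u} u≢v with shortest u
    ... | zero  , u≡v          , _ = contradiction u≡v u≢v
    ... | suc m , (w , uw , p) , _ = w , uw , s≤s (ℕ.≮⇒≥ λ m<d → proj₂ (proj₂ (shortest w)) m<d p)

  -- An edge is stored once, with its ends in increasing order; this relation reads it in either
  -- direction.
  data Joins : Edge T → V T → V T → Set where
    forwards  : ∀ {u w p} → Joins ((u , w) , p) u w
    backwards : ∀ {u w p} → Joins ((u , w) , p) w u

  edge-between : ∀ {u w} → Adj T u w → ∃[ e ] Joins e u w
  edge-between {u} {w} uw with <-cmp u w
  ... | tri< u<w _ _ = ((u , w) , u<w , uw) , forwards
  ... | tri≈ _ refl _ = contradiction uw Adj-irrefl
  ... | tri> _ _ w<u = ((w , u) , w<u , Adj-sym uw) , backwards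

  Joins-unique : ∀ {e e′ u w} → Joins e u w → Joins e′ u w → e ≡ e′
  Joins-unique (forwards {p = p , q}) (forwards {p = p′ , q′}) =
    cong₂ (λ p q → _ , p , q) (<ᶠ-irrelevant p p′) (T-irrelevant q q′)
  Joins-unique (backwards {p = p , q}) (backwards {p = p′ , q′}) =
    cong₂ (λ p q → _ , p , q) (<ᶠ-irrelevant p p′) (T-irrelevant q q′)
  Joins-unique (forwards {p = p , _}) (backwards {p = p′ , _}) = contradiction p′ (ℕ.<-asym p)
  Joins-unique (backwards {p = p , _}) (forwards {p = p′ , _}) = contradiction p′ (ℕ.<-asym p)

  Joins⇒Endpointˡ : ∀ {e u w} → Joins e u w → Endpoint T u e
  Joins⇒Endpointˡ forwards  = inj₁ refl
  Joins⇒Endpointˡ backwards = inj₂ refl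

  Joins⇒Endpointʳ : ∀ {e u w} → Joins e u w → Endpoint T w e
  Joins⇒Endpointʳ forwards  = inj₂ refl
  Joins⇒Endpointʳ backwards = inj₁ refl

  Endpoint⇒Joins : ∀ {u} e → Endpoint T u e → ∃[ w ] Adj T u w × Joins e u w
  Endpoint⇒Joins ((_ , w) , _ , uw) (inj₁ refl) = w , uw , forwards
  Endpoint⇒Joins ((w , _) , _ , wu) (inj₂ refl) = w , Adj-sym wu , backwards

  Joins-ends : ∀ {e u w u′ w′} → Joins e u w → Joins e u′ w′ → u ≡ u′ ⊎ (u ≡ w′ × u′ ≡ w)
  Joins-ends forwards  forwards  = inj₁ refl
  Joins-ends forwards  backwards = inj₂ (refl , refl)
  Joins-ends backwards forwards  = inj₂ (refl , refl)
  Joins-ends backwards backwards = inj₁ refl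

  Original : SubdivisionVertex T → Set
  Original a = ∃[ w ] a ≡ inj₁ w

  private
    _~_ : SubdivisionVertex T → SubdivisionVertex T → Set
    _~_ = SubdivisionAdj T

  -- Matchings in a subdivided tree

  module _ (connected : Connected) (v : V T) where

    private
      data ParentEdge : SubdivisionVertex T → SubdivisionVertex T → Set where
        parentEdge : ∀ {u w e} → Joins e u w → distance connected v w < distance connected v u →
                     ParentEdge (inj₁ u) (inj₂ e)

    -- With `T` rooted at `v`, each other vertex is matched to an edge leading closer to the root.
    -- Such an edge serves only its farther end.
    subdivision-matching : Matching _~_ Original (inj₁ v)
    subdivision-matching = record
      { Matched      = ParentEdge
      ; total        = λ { (u , refl) u≢v →
          let w , uw , lt = closer connected v (u≢v ∘ cong inj₁)
              e , joins   = edge-between uw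
          in inj₂ e , parentEdge joins lt }
      ; adjacent     = λ { (parentEdge joins _) → Joins⇒Endpointˡ joins }
      ; cofunctional = cofunctional
      }
      where
      cofunctional : ∀ {a b c} → ParentEdge a c → ParentEdge b c → a ≡ b
      cofunctional (parentEdge j lt) (parentEdge j′ lt′) with Joins-ends j j′
      ... | inj₁ refl          = refl
      ... | inj₂ (refl , refl) = contradiction lt (ℕ.<-asym lt′)

  -- Elimination of a subdivided tree

  module _ (acyclic : ¬ Cycle) where

    private
      -- S is the set of vertices of T not yet eliminated; Staller has then
      -- claimed the edges in Cut S.
      Spanned : Subset (order T) → SubdivisionVertex T → Set
      Spanned S (inj₁ w) = w ∈ S
      Spanned S (inj₂ e) = ∀ {w} → Endpoint T w e → w ∈ S

      Cut : Subset (order T) → SubdivisionVertex T → Set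
      Cut S (inj₁ w) = ⊥
      Cut S (inj₂ e) = ∃[ w ] Endpoint T w e × w ∉ S

      is? : ∀ u → Decidable {A = SubdivisionVertex T} (_≡ inj₁ u)
      is? u (inj₂ _) = no λ ()
      is? u (inj₁ w) with w ≟ u
      ... | yes refl = yes refl
      ... | no  w≢u  = no λ { refl → w≢u refl }

      -- Induction on the size of `S`. A vertex `u` with at most one neighbour in `S` becomes a
      -- leaf; if there is such a neighbour, the edge to it is claimed first, and the other branch
      -- eliminates `S - u`.
      eliminate : ∀ S {r} → Acc _<_ ∣ S ∣ → r ∈ S → Elimination _~_ Original (Cut S) (Spanned S)
      eliminate S (acc rs) r∈S with acyclic⇒almostIsolated acyclic S r∈S
      -- `p` may be a junk value. If it is not a neighbour of `u` in `S`, then `u` has none there,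
      -- and all edges at `u` are cut.
      ... | u , p , u∈S , almost with Adj? u p ×-dec (p ∈? S)
      ... | no ¬up = leaf {x = inj₁ u} u∈S (u , refl) neighbours
        where
        neighbours : ∀ {a} → inj₁ u ~ a → Cut S a
        neighbours {inj₂ e} inc with Endpoint⇒Joins e inc
        ... | w , uw , joins = w , Joins⇒Endpointʳ joins ,
          λ w∈S → ¬up (subst (λ p → Adj T u p × p ∈ S) (almost w w∈S uw) (uw , w∈S))
      ... | yes (up , p∈S) = node {y = inj₂ e} {_≡ inj₁ u} {Spanned (S - u)}
          spanned (is? u) (λ { refl → u∈S , λ () }) rest (λ { refl → x∉p-x })
          (leaf refl (u , refl) neighbours)
          (Elimination-mono cut id (eliminate (S - u) (rs (x∈p⇒∣p-x∣<∣p∣ u∈S)) p∈S-u))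
        where
        e : Edge T
        e = proj₁ (edge-between up)
        joins : Joins e u p
        joins = proj₂ (edge-between up)
        spanned : Spanned S (inj₂ e)
        spanned inc with Endpoint⇒Joins e inc
        ... | _ , _ , joins′ with Joins-ends joins joins′
        ... | inj₁ refl       = u∈S
        ... | inj₂ (_ , refl) = p∈S
        rest : ∀ {a} → Spanned (S - u) a → Spanned S a × a ≢ inj₂ e
        rest {inj₁ w} w∈S-u = p─q⊆p S ⁅ u ⁆ w∈S-u , λ ()
        rest {inj₂ f} ends  = (λ inc → p─q⊆p S ⁅ u ⁆ (ends inc)) ,
          λ { refl → x∉p-x (ends (Joins⇒Endpointˡ joins)) }
        p∈S-u : p ∈ S - u
        p∈S-u = x∈p∧x≢y⇒x∈p-y p∈S λ { refl → Adj-irrefl up }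
        neighbours : ∀ {a} → inj₁ u ~ a → Cut S a ⊎ a ≡ inj₂ e
        neighbours {inj₂ f} inc with Endpoint⇒Joins f inc
        ... | w , uw , joins′ with w ∈? S
        ... | no  w∉S = inj₁ (w , Joins⇒Endpointʳ joins′ , w∉S)
        ... | yes w∈S with almost w w∈S uw
        ... | refl = inj₂ (cong inj₂ (Joins-unique joins′ joins))
        cut : ∀ {a} → Cut (S - u) a → Cut S a ⊎ a ≡ inj₂ e
        cut {inj₂ f} (w , inc , w∉S-u) with w ≟ u
        -- An edge that becomes cut by the removal of `u` ends at `u`, so it is `e`.
        ... | yes refl = neighbours {inj₂ f} inc
        ... | no  w≢u  = inj₁ (w , inc , λ w∈S → w∉S-u (x∈p∧x≢y⇒x∈p-y w∈S w≢u))

    subdivision-elimination : V T → Elimination _~_ Original (λ _ → ⊥) (λ _ → Unit.⊤)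
    subdivision-elimination r =
      Elimination-mono nothing-cut _ (eliminate ⊤ {r} (<-wellFounded _) ∈⊤)
      where
      nothing-cut : ∀ {a} → Cut ⊤ a → ⊥
      nothing-cut {inj₂ _} (_ , _ , w∉⊤) = w∉⊤ ∈⊤

  subdivision-certificate : IsTree T → Certificate _~_ Original
  subdivision-certificate isTree = record
    { bipartite   = bipartite
    ; noIsolated  = noIsolated
    ; matching    = λ { (v , refl) → subdivision-matching connected v }
    ; elimination = subdivision-elimination acyclic (fromℕ< (>-nonZero⁻¹ _ {{nonempty}}))
    }
    where
    open IsTree isTree
    bipartite : ∀ {a b} → a ~ b → (Original a × ¬ Original b) ⊎ (¬ Original a × Original b)
    bipartite {inj₁ u} {inj₂ _} _ = inj₁ ((u , refl) , λ ())
    bipartite {inj₂ _} {inj₁ u} _ = inj₂ ((λ ()) , (u , refl))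
    noIsolated : ∀ {a} → ¬ Original a → ∃ (a ~_)
    noIsolated {inj₁ u}               ¬orig = contradiction (u , refl) ¬orig
    noIsolated {inj₂ ((u , _) , _)} _     = inj₁ u , inj₁ refl

subdivided⇒certificate : ∀ {A X} → SubdividedTree A X → Certificate (Adj A) (_∈ X)
subdivided⇒certificate s =
  Certificate-realise realises X-is-V-tree (subdivision-certificate tree isTree)
  where open SubdividedTree s

-- Odd replacements

-- Halved positions are written `q * 2` because `suc q * 2` computes to `suc (suc (q * 2))`; the
-- bounds `2 * h i` are converted by commutativity.
parity : ∀ n → ∃[ q ] (n ≡ q * 2 ⊎ n ≡ suc (q * 2))
parity zero = 0 , inj₁ refl
parity (suc n) with parity n
... | q , inj₁ refl = q , inj₂ refl
... | q , inj₂ refl = suc q , inj₁ refl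

suc*2<⇒< : ∀ {q n} → suc (q * 2) < 2 * n → q < n
suc*2<⇒< {q} {n} lt = ℕ.*-cancelʳ-< 2 q n
  (ℕ.<-trans (ℕ.n<1+n _) (subst (suc (q * 2) <_) (ℕ.*-comm 2 n) lt))

<⇒suc*2< : ∀ {q n} → q < n → suc (q * 2) < 2 * n
<⇒suc*2< {q} {n} lt = subst (suc (suc (q * 2)) ≤_) (ℕ.*-comm n 2) (ℕ.*-monoˡ-≤ 2 lt)

-- Positions along the new paths

module _ (A : Graph) (x y : V A) {k : ℕ} (h : Fin k → ℕ) where

  At-vertex : ∀ i p → p ≤ suc (2 * h i) → ∃ (At A x y h i p)
  At-vertex i zero    _ = inj₁ x , start
  At-vertex i (suc p) (s≤s p≤) with ℕ.m≤n⇒m<n∨m≡n p≤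
  ... | inj₂ refl = inj₁ y , end
  ... | inj₁ p<   = inj₂ (i , fromℕ< p<) ,
    subst (λ q → At A x y h i (suc q) (inj₂ (i , fromℕ< p<))) (toℕ-fromℕ< p<) (inner (fromℕ< p<))

  At-bound : ∀ {i p a} → At A x y h i p a → p ≤ suc (2 * h i)
  At-bound start     = z≤n
  At-bound (inner j) = s≤s (ℕ.<⇒≤ (toℕ<n j))
  At-bound end       = ℕ.≤-refl

  -- The equation of positions is a separate argument because indices such as `suc (toℕ j)` do not
  -- unify by pattern matching.
  At-functional : ∀ {i p p′ a b} → At A x y h i p a → At A x y h i p′ b → p ≡ p′ → a ≡ b
  At-functional start     start      _  = refl
  At-functional (inner j) (inner j′) eq = cong (λ j → inj₂ (_ , j)) (toℕ-injective (ℕ.suc-injective eq))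
  At-functional (inner j) end        eq = contradiction (ℕ.suc-injective eq) (ℕ.<⇒≢ (toℕ<n j))
  At-functional end       (inner j)  eq = contradiction (sym (ℕ.suc-injective eq)) (ℕ.<⇒≢ (toℕ<n j))
  At-functional end       end        _  = refl

  At-inner : ∀ {i p a i′ j} → At A x y h i p a → a ≡ inj₂ (i′ , j) → i ≡ i′ × p ≡ suc (toℕ j)
  At-inner (inner _) refl = refl , refl

  At-old : ∀ {i p a u} → At A x y h i p a → a ≡ inj₁ u →
           (u ≡ x × p ≡ 0) ⊎ (u ≡ y × p ≡ suc (2 * h i))
  At-old start refl = inj₁ (refl , refl)
  At-old end   refl = inj₂ (refl , refl)

-- Reversal of all paths, so that x may be assumed to lie in X.
module _ (A : Graph) (x y : V A) {k : ℕ} (h : Fin k → ℕ) where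

  reversePaths : ReplacementVertex A x y h → ReplacementVertex A y x h
  reversePaths (inj₁ u)       = inj₁ u
  reversePaths (inj₂ (i , j)) = inj₂ (i , opposite j)

  reversePaths-At : ∀ {i p a} → At A x y h i p a →
                    At A y x h i (suc (2 * h i) ∸ p) (reversePaths a)
  reversePaths-At start = end
  reversePaths-At {i} (inner j) =
    subst (λ p → At A y x h i p (inj₂ (i , opposite j)))
      (trans (cong suc (opposite-prop j)) (sym (ℕ.+-∸-assoc 1 (toℕ<n j))))
      (inner (opposite j))
  reversePaths-At {i} end =
    subst (λ p → At A y x h i p (inj₁ y)) (sym (ℕ.n∸n≡0 (2 * h i))) start

  private
    step-back : ∀ {i p} → suc p ≤ suc (2 * h i) → suc (2 * h i) ∸ p ≡ suc (suc (2 * h i) ∸ suc p)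
    step-back (s≤s p≤) = ℕ.+-∸-assoc 1 p≤

    reversed : ∀ {i p a b} → At A x y h i p a → At A x y h i (suc p) b →
               At A y x h i (suc (suc (2 * h i) ∸ suc p)) (reversePaths a)
    reversed {i} {a = a} s t = subst (λ p → At A y x h i p (reversePaths a))
      (step-back (At-bound A x y h t)) (reversePaths-At s)

  reversePaths-Adj : ∀ {a b} → ReplacementAdj A x y h a b →
                     ReplacementAdj A y x h (reversePaths a) (reversePaths b)
  reversePaths-Adj (kept uv ¬xy ¬yx) = kept uv ¬yx ¬xy
  reversePaths-Adj (forward s t)     = backward (reversePaths-At t) (reversed s t)
  reversePaths-Adj (backward s t)    = forward (reversePaths-At t) (reversed s t)

module _ {A A′ : Graph} {x y : V A} {k : ℕ} {h : Fin k → ℕ} where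

  reversePaths-realises : Realises A′ (ReplacementAdj A x y h) →
                          Realises A′ (ReplacementAdj A y x h)
  reversePaths-realises realises = record
    { bijection = mk↔ₛ′ (rev x y ∘ to) (from ∘ rev y x)
        (λ b → trans (cong (rev x y) (Inverse.strictlyInverseˡ bijection _)) (involutive x y b))
        (λ a → trans (cong from (involutive y x (to a))) (Inverse.strictlyInverseʳ bijection a))
    ; adjacency = λ a b → mk⇔
        (reversePaths-Adj A x y h ∘ Equivalence.to (adjacency a b))
        (Equivalence.from (adjacency a b) ∘
          subst₂ (ReplacementAdj A x y h) (involutive y x (to a)) (involutive y x (to b)) ∘
          reversePaths-Adj A y x h)
    }
    where
    open Realises realises
    rev : ∀ x y → ReplacementVertex A x y h → ReplacementVertex A y x h
    rev x y = reversePaths A x y h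
    involutive : ∀ x y a → rev x y (rev y x a) ≡ a
    involutive x y (inj₁ _)       = refl
    involutive x y (inj₂ (i , j)) = cong (λ j → inj₂ (i , j)) (opposite-involutive j)

-- The certificate of a replacement with `x` in `X`

module _ {A : Graph} {X : Subset (order A)} (C : Certificate (Adj A) (_∈ X))
         {x y : V A} (xy : Adj A x y) (x∈X : x ∈ X) {k : ℕ} (h : Fin k → ℕ) (i₀ : Fin k)
         {In : ReplacementVertex A x y h → Set}
         (bipartite : ∀ {a b} → ReplacementAdj A x y h a b →
                      (In a × ¬ In b) ⊎ (¬ In a × In b))
         (old : ∀ {u} → u ∈ X → In (inj₁ u)) where

  private
    module C = Certificate C

    W : Set
    W = ReplacementVertex A x y h

    _~_ : W → W → Set
    _~_ = ReplacementAdj A x y h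

    at : Fin k → ℕ → W → Set
    at = At A x y h

    x≢y : x ≢ y
    x≢y refl = Adj-irrefl A xy

    opposite-side : ∀ {u v} → u ∈ X → Adj A u v → v ∉ X
    opposite-side u∈X uv with C.bipartite uv
    ... | inj₁ (_ , v∉X) = v∉X
    ... | inj₂ (u∉X , _) = contradiction u∈X u∉X

    y∉X : y ∉ X
    y∉X = opposite-side x∈X xy

    previous : ∀ {i p b} → at i (suc p) b → ∃[ a ] at i p a × a ~ b
    previous {i} {p} t with At-vertex A x y h i p (ℕ.≤-trans (ℕ.n≤1+n p) (At-bound A x y h t))
    ... | a , s = a , s , forward s t

    -- Of `In` it is only known that it is a bipartition class containing `X`, so sides are
    -- propagated along the path from `x`.
    even∈ : ∀ {i} q {a} → at i (q * 2) a → In a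
    odd∉  : ∀ {i} q {a} → at i (suc (q * 2)) a → ¬ In a

    even∈ zero    s = subst In (At-functional A x y h start s refl) (old x∈X)
    even∈ (suc q) t with previous t
    ... | a , s , ab with bipartite ab
    ... | inj₁ (a∈ , _) = contradiction a∈ (odd∉ q s)
    ... | inj₂ (_ , b∈) = b∈

    odd∉ q t with previous t
    ... | a , s , ab with bipartite ab
    ... | inj₁ (_ , b∉) = b∉
    ... | inj₂ (a∉ , _) = contradiction (even∈ q s) a∉

    y-odd : ∀ i → at i (suc (h i * 2)) (inj₁ y)
    y-odd i = subst (λ p → at i (suc p) (inj₁ y)) (ℕ.*-comm 2 (h i)) end

    inner-even : ∀ {i} {j : Fin (2 * h i)} → In (inj₂ (i , j)) → ∃[ q ] toℕ j ≡ suc (q * 2)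
    inner-even {i} {j} j∈ with parity (toℕ j)
    ... | q , inj₂ eq = q , eq
    ... | q , inj₁ eq = contradiction j∈ (odd∉ q (subst (λ p → at i (suc p) _) eq (inner j)))

    not-both : ∀ {u w} → u ∈ X → ¬ (u ≡ y × w ≡ x)
    not-both u∈X (refl , _) = y∉X u∈X

    -- A vertex outside `X` other than `y` keeps a neighbour in `X`, which puts it on the other
    -- side. For `y` the edge to `x` may be the only one, so its odd position on the path `i₀` is
    -- used instead.
    old⁻ : ∀ {u} → In (inj₁ u) → u ∈ X
    old⁻ {u} u∈ with u ∈? X
    ... | yes u∈X = u∈X
    ... | no  u∉X with u ≟ y
    ...   | yes refl = contradiction u∈ (odd∉ (h i₀) (y-odd i₀))
    ...   | no  u≢y with C.noIsolated u∉X
    ...     | w , uw with C.bipartite uw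
    ...       | inj₁ (u∈X , _) = u∈X
    ...       | inj₂ (_ , w∈X)
                with bipartite (kept uw (λ { (refl , _) → u∉X x∈X }) (λ { (refl , _) → u≢y refl }))
    ...         | inj₁ (_ , w∉) = contradiction (old w∈X) w∉
    ...         | inj₂ (u∉ , _) = contradiction u∈ u∉

    noIsolated : ∀ {a} → ¬ In a → ∃ (a ~_)
    noIsolated {inj₂ (i , j)} _ =
      let b , s = At-vertex A x y h i (toℕ j) (ℕ.m≤n⇒m≤1+n (ℕ.<⇒≤ (toℕ<n j)))
      in b , backward s (inner j)
    noIsolated {inj₁ u} u∉ with u ≟ y
    ... | yes refl = let b , s = At-vertex A x y h i₀ (2 * h i₀) (ℕ.n≤1+n _) in b , backward s end
    ... | no  u≢y  =
      let w , uw = C.noIsolated (u∉ ∘ old)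
      in inj₁ w , kept uw (λ { (refl , _) → u∉ (old x∈X) }) (λ { (refl , _) → u≢y refl })

    -- This keeps partners on the paths distinct: `x` has position 0, so at odd positions the paths
    -- can meet only in their common end `y`.
    odd-unique : ∀ {i i′} q q′ {b} → at i (suc (q * 2)) b → at i′ (suc (q′ * 2)) b →
                 (i ≡ i′ × q ≡ q′) ⊎ (b ≡ inj₁ y × q ≡ h i × q′ ≡ h i′)
    odd-unique q q′ {inj₁ u} s t
      with At-old A x y h s refl | At-old A x y h t refl
    ... | inj₂ (refl , p) | inj₂ (_ , p′) = inj₂ (refl , half p , half p′)
      where
      half : ∀ {q n} → suc (q * 2) ≡ suc (2 * n) → q ≡ n
      half {q} {n} eq = ℕ.*-cancelʳ-≡ q n 2 (trans (ℕ.suc-injective eq) (ℕ.*-comm 2 n))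
    odd-unique q q′ {inj₂ _} s t
      with At-inner A x y h s refl | At-inner A x y h t refl
    ... | refl , p | refl , p′ =
      inj₁ (refl , ℕ.*-cancelʳ-≡ q q′ 2 (ℕ.suc-injective (trans p (sym p′))))

    odd-old : ∀ {i} q {w} → at i (suc (q * 2)) (inj₁ w) → w ≡ y × q ≡ h i
    odd-old q s with At-old A x y h s refl
    ... | inj₂ (refl , _) with odd-unique q _ s (y-odd _)
    ...   | inj₁ (_ , q≡h)     = refl , q≡h
    ...   | inj₂ (_ , q≡h , _) = refl , q≡h

    beyond : ∀ {i} q {a} → at i (suc q * 2) a → q ≢ h i
    beyond {i} q s refl = ℕ.<⇒≱ (ℕ.n<1+n _)
      (subst (suc (h i) * 2 ≤_) (cong suc (ℕ.*-comm 2 (h i))) (At-bound A x y h s))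

    -- On the i-th path, the vertices of X at positions 2 q with q < τ i are
    -- matched towards y, those with q > τ i towards x, and the one at
    -- position 2 τ i (if any) is left to the rest of the graph.
    module _ (v : W) (M : V A → V A → Set) (τ : Fin k → ℕ)
             (M-adjacent     : ∀ {u w} → M u w → Adj A u w)
             (M-cofunctional : ∀ {u u′ w} → M u w → M u′ w → u ≡ u′)
             (∉xy            : ¬ M x y)
             (∈X             : ∀ {u w} → M u w → u ∈ X)
             (one-path       : ∀ {i i′} → 0 < τ i → 0 < τ i′ → i ≡ i′)
             (y-free         : ∀ {i u} → h i < τ i → ¬ M u y)
             (x-matched      : inj₁ x ≢ v → (∃[ i ] 0 < τ i) ⊎ ∃ (M x))
             (M-total        : ∀ {u} → u ∈ X → inj₁ u ≢ v → u ≢ x → ∃ (M u))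
             (at-τ           : ∀ {i q a} → suc q ≤ h i → at i (suc q * 2) a → τ i ≡ suc q → a ≡ v) where

      -- `up` matches `x` itself when `q` is 0 and uses `y` when `q` is `h i`. Thus `one-path`
      -- prevents two paths from both using `y`, and `y-free` keeps `M` away from it. `down` reaches
      -- neither end.
      data Rematched : W → W → Set where
        retained : ∀ {u w} → M u w → Rematched (inj₁ u) (inj₁ w)
        up       : ∀ {i q a b} → q < τ i → at i (q * 2) a → at i (suc (q * 2)) b → Rematched a b
        down     : ∀ {i q a b} → τ i ≤ q → at i (suc q * 2) a → at i (suc (q * 2)) b → Rematched a b

      matched-total : ∀ {a} → In a → a ≢ v → ∃ (Rematched a)
      matched-total {inj₁ u} u∈ u≢v with u ≟ x
      ... | no  u≢x = let w , uw = M-total (old⁻ u∈) u≢v u≢x in inj₁ w , retained uw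
      ... | yes refl with x-matched u≢v
      ...   | inj₂ (w , xw) = inj₁ w , retained xw
      ...   | inj₁ (i , 0<τ) =
        let b , t = At-vertex A x y h i 1 (s≤s z≤n) in b , up 0<τ start t
      matched-total {inj₂ (i , j)} j∈ j≢v with inner-even j∈
      ... | q , eq with subst (λ p → at i (suc p) (inj₂ (i , j))) eq (inner j)
                    | suc*2<⇒< (subst (_< 2 * h i) eq (toℕ<n j))
      -- Positions exceed inner indices by one, so the vertex is at position `suc q * 2` and `suc q`
      -- is what the threshold is compared with.
      ... | s | q<h with ℕ.<-cmp (suc q) (τ i)
      ... | tri< q<τ _ _ =
        let b , t = At-vertex A x y h i (suc (suc q * 2))
                      (s≤s (subst (suc q * 2 ≤_) (ℕ.*-comm (h i) 2) (ℕ.*-monoˡ-≤ 2 q<h)))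
        in b , up q<τ s t
      ... | tri≈ _ q≡τ _ = contradiction (at-τ q<h s (sym q≡τ)) j≢v
      ... | tri> _ _ τ<q = let b , t , _ = previous s in b , down (s≤s⁻¹ τ<q) s t

      matched-adjacent : ∀ {a b} → Rematched a b → a ~ b
      matched-adjacent (retained uw) = kept (M-adjacent uw)
        (λ { (refl , refl) → ∉xy uw }) (not-both (∈X uw))
      matched-adjacent (up _ s t)    = forward s t
      matched-adjacent (down _ s t)  = backward t s

      retained-up : ∀ {u w i q} → M u w → q < τ i → ¬ at i (suc (q * 2)) (inj₁ w)
      retained-up {q = q} uw q<τ t with odd-old q t
      ... | refl , refl = y-free q<τ uw

      retained-down : ∀ {u w i} q {a} → M u w → at i (suc q * 2) a → ¬ at i (suc (q * 2)) (inj₁ w)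
      retained-down q uw s t = beyond q s (proj₂ (odd-old q t))

      up-down : ∀ {i i′ q q′ a b} → q < τ i → at i (suc (q * 2)) b →
                τ i′ ≤ q′ → at i′ (suc q′ * 2) a → ¬ at i′ (suc (q′ * 2)) b
      up-down {q = q} {q′} q<τ t τ≤q s t′ with odd-unique q q′ t t′
      ... | inj₁ (refl , refl) = ℕ.<⇒≱ q<τ τ≤q
      ... | inj₂ (_ , _ , q′≡h) = beyond q′ s q′≡h

      matched-cofunctional : ∀ {a a′ b} → Rematched a b → Rematched a′ b → a ≡ a′
      matched-cofunctional (retained p)   (retained q)    = cong inj₁ (M-cofunctional p q)
      matched-cofunctional (retained p)   (up q<τ _ t)    = contradiction t (retained-up p q<τ)
      matched-cofunctional (up q<τ _ t)   (retained p)    = contradiction t (retained-up p q<τ)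
      matched-cofunctional (retained p)   (down {q = q} _ s t) = contradiction t (retained-down q p s)
      matched-cofunctional (down {q = q} _ s t) (retained p) = contradiction t (retained-down q p s)
      matched-cofunctional (up q<τ _ t)   (down τ≤q s t′) = contradiction t′ (up-down q<τ t τ≤q s)
      matched-cofunctional (down τ≤q s t) (up q<τ _ t′)   = contradiction t (up-down q<τ t′ τ≤q s)
      matched-cofunctional (up {q = q} q<τ s t) (up {q = q′} q′<τ s′ t′) with odd-unique q q′ t t′
      ... | inj₁ (refl , refl) = At-functional A x y h s s′ refl
      ... | inj₂ (_ , refl , refl) with one-path (ℕ.≤-<-trans z≤n q<τ) (ℕ.≤-<-trans z≤n q′<τ)
      ...   | refl = At-functional A x y h s s′ refl
      matched-cofunctional (down {q = q} _ s t) (down {q = q′} _ s′ t′) with odd-unique q q′ t t′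
      ... | inj₁ (refl , refl)    = At-functional A x y h s s′ refl
      ... | inj₂ (_ , q≡h , _) = contradiction q≡h (beyond q s)

      threshold-matching : Matching _~_ In v
      threshold-matching = record
        { Matched      = Rematched
        ; total        = matched-total
        ; adjacent     = matched-adjacent
        ; cofunctional = matched-cofunctional
        }

    -- Choice of the thresholds

    single : Fin k → ℕ → Fin k → ℕ
    single i t = updateAt (const 0) i (const t)

    single-here : ∀ i t → single i t i ≡ t
    single-here i t = updateAt-updates i (const 0)

    single-support : ∀ {i t i′} → 0 < single i t i′ → i′ ≡ i
    single-support {i} {t} {i′} 0< with i′ ≟ i
    ... | yes eq = eq
    ... | no neq = contradiction (updateAt-minimal i′ i (const 0) neq) (ℕ.>⇒≢ 0<)

    single-unique : ∀ {i t i′ i″} → 0 < single i t i′ → 0 < single i t i″ → i′ ≡ i″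
    single-unique p q = trans (single-support p) (sym (single-support q))

    -- The old matching that misses `v` survives with all thresholds 0, unless it uses the edge from
    -- `x` to `y`.
    matching-old : ∀ {v} → v ∈ X → Matching _~_ In (inj₁ v)
    matching-old {v} v∈X with x ≟ v
    ... | yes refl = threshold-matching (inj₁ x) M (const 0)
        (adjacent ∘ proj₂ ∘ proj₂) (λ p q → cofunctional (proj₂ (proj₂ p)) (proj₂ (proj₂ q)))
        (λ p → proj₁ (proj₂ p) refl) proj₁ (λ ()) (λ ())
        (λ x≢x → contradiction refl x≢x)
        (λ u∈X _ u≢x → let w , uw = total u∈X u≢x in w , u∈X , u≢x , uw)
        (λ _ _ ())
      where
      open Matching (C.matching v∈X)
      M : V A → V A → Set
      M u w = u ∈ X × u ≢ x × Matched u w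
    ... | no x≢v with Matching.total (C.matching v∈X) x∈X x≢v
    ...   | w , xw with w ≟ y
    -- `x` is rerouted along the path `i₀`: with threshold `suc (h i₀)` all its vertices of `X` are
    -- matched towards `y`, and the last of them takes over `y`.
    ...     | yes refl = threshold-matching (inj₁ v) M (single i₀ (suc (h i₀)))
        (adjacent ∘ proj₂ ∘ proj₂) (λ p q → cofunctional (proj₂ (proj₂ p)) (proj₂ (proj₂ q)))
        (λ p → proj₁ (proj₂ p) refl) proj₁ single-unique
        (λ _ (_ , u≢x , uy) → u≢x (cofunctional uy xw))
        (λ _ → inj₁ (i₀ , subst (0 <_) (sym (single-here i₀ _)) (s≤s z≤n)))
        (λ u∈X u≢v u≢x → let w , uw = total u∈X (u≢v ∘ cong inj₁) in w , u∈X , u≢x , uw)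
        above
      where
      open Matching (C.matching v∈X)
      M : V A → V A → Set
      M u w = u ∈ X × u ≢ x × Matched u w
      above : ∀ {i q a} → suc q ≤ h i → at i (suc q * 2) a →
              single i₀ (suc (h i₀)) i ≡ suc q → a ≡ inj₁ v
      above q<h _ eq with single-support (subst (0 <_) (sym eq) (s≤s z≤n))
      ... | refl = contradiction (trans (sym (single-here i₀ _)) eq) (ℕ.>⇒≢ (s≤s q<h))
    -- `x` keeps the partner `w`. The relation `Matched` might also relate `x` to `y`, so that pair
    -- is removed.
    ...     | no w≢y = threshold-matching (inj₁ v) M (const 0)
        (adjacent ∘ proj₁ ∘ proj₂) (λ p q → cofunctional (proj₁ (proj₂ p)) (proj₁ (proj₂ q)))
        (λ p → proj₂ (proj₂ p) (refl , refl)) proj₁ (λ ()) (λ ())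
        (λ _ → inj₂ (w , x∈X , xw , w≢y ∘ proj₂))
        (λ u∈X u≢v u≢x → let w , uw = total u∈X (u≢v ∘ cong inj₁) in w , u∈X , uw , u≢x ∘ proj₁)
        (λ _ _ ())
      where
      open Matching (C.matching v∈X)
      M : V A → V A → Set
      M u w = u ∈ X × Matched u w × ¬ (u ≡ x × w ≡ y)

    -- Starts from the old matching that misses `x`. The threshold is placed at the vertex to be
    -- missed, so `x` and the vertices of `X` before it move towards `y`, those after it towards
    -- `x`, and `y` stays available to the old matching.
    matching-new : ∀ {i j} → In (inj₂ (i , j)) → Matching _~_ In (inj₂ (i , j))
    matching-new {i} {j} j∈ with inner-even j∈
    ... | q , eq = threshold-matching (inj₂ (i , j)) M (single i (suc q))
        (adjacent ∘ proj₂ ∘ proj₂) (λ p q → cofunctional (proj₂ (proj₂ p)) (proj₂ (proj₂ q)))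
        (λ p → proj₁ (proj₂ p) refl) proj₁ single-unique
        below
        (λ _ → inj₁ (i , subst (0 <_) (sym (single-here i _)) (s≤s z≤n)))
        (λ u∈X _ u≢x → let w , uw = total u∈X u≢x in w , u∈X , u≢x , uw)
        unmatched
      where
      open Matching (C.matching x∈X)
      M : V A → V A → Set
      M u w = u ∈ X × u ≢ x × Matched u w
      below : ∀ {i′ u} → h i′ < single i (suc q) i′ → ¬ M u y
      below lt _ with single-support (ℕ.≤-<-trans z≤n lt)
      ... | refl = ℕ.<⇒≱ (subst (h i <_) (single-here i _) lt) (suc*2<⇒< (subst (_< 2 * h i) eq (toℕ<n j)))
      unmatched : ∀ {i′ q′ a} → suc q′ ≤ h i′ → at i′ (suc q′ * 2) a →
                  single i (suc q) i′ ≡ suc q′ → a ≡ inj₂ (i , j)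
      unmatched {q′ = q′} _ s eq′ with single-support (subst (0 <_) (sym eq′) (s≤s z≤n))
      ... | refl with trans (sym (single-here i _)) eq′
      ... | refl = At-functional A x y h s (inner j) (cong suc (sym eq))

    matching : ∀ {a} → In a → Matching _~_ In a
    matching {inj₁ v} v∈ = matching-old (old⁻ v∈)
    matching {inj₂ _} j∈ = matching-new j∈

    -- Elimination along the new paths

    even-inner : ∀ {i} q {u} → ¬ at i (suc q * 2) (inj₁ u)
    even-inner q s with At-old A x y h s refl
    ... | inj₂ (refl , _) = y∉X (old⁻ (even∈ (suc q) s))

    even-unique : ∀ {i i′} q q′ {a} → at i (suc q * 2) a → at i′ (suc q′ * 2) a → i ≡ i′ × q ≡ q′
    even-unique q q′ {inj₁ _} s t = contradiction s (even-inner q)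
    even-unique q q′ {inj₂ _} s t with At-inner A x y h s refl | At-inner A x y h t refl
    ... | refl , p | refl , p′ =
      refl , ℕ.suc-injective (ℕ.*-cancelʳ-≡ (suc q) (suc q′) 2 (trans p (sym p′)))

    even-neighbours : ∀ {i} q {a b} → at i (suc q * 2) a → a ~ b →
                      at i (suc (q * 2)) b ⊎ at i (suc (suc q * 2)) b
    even-neighbours q {inj₁ _} s _ = contradiction s (even-inner q)
    even-neighbours q {inj₂ _} s (forward s′ t)
      with At-inner A x y h s refl | At-inner A x y h s′ refl
    ... | refl , p | refl , p′ with trans p (sym p′)
    ... | refl = inj₂ t
    even-neighbours q {inj₂ _} s (backward t s′)
      with At-inner A x y h s refl | At-inner A x y h s′ refl
    ... | refl , p | refl , p′ with trans p (sym p′)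
    ... | refl = inj₁ t

    _≟ᵂ_ : DecidableEquality W
    _≟ᵂ_ = Sum.≡-dec _≟_ (Product.≡-dec _≟_ _≟_)

    -- On the i-th path, the r i pairs of inner vertices nearest to x remain
    -- to be played.
    data Claimed (r : Fin k → ℕ) : W → Set where
      neighbour : ∀ {u} → Adj A x u → Claimed r (inj₁ u)
      passed    : ∀ {i} q {a} → r i ≤ q → at i (suc (q * 2)) a → Claimed r a

    data Remaining (r : Fin k → ℕ) : W → Set where
      root : Remaining r (inj₁ x)
      odd  : ∀ {i} q {a} → q < r i → at i (suc (q * 2)) a → Remaining r a
      even : ∀ {i} q {a} → q < r i → at i (suc q * 2) a → Remaining r a

    -- At `r = h` this is the subtree that replaces the leaf `x`, with `y` already claimed as an old
    -- neighbour of `x`; when `r` vanishes, only `x` is left to claim.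
    Goal : (Fin k → ℕ) → Set₁
    Goal r = Elimination _~_ In (Claimed r) (Remaining r)

    module _ {r : Fin k → ℕ} (r≤h : ∀ i → r i ≤ h i) {i : Fin k} {n : ℕ} (ri≡ : r i ≡ suc n) where

      private
        r′ : Fin k → ℕ
        r′ = updateAt r i (const n)

        r′i≡ : r′ i ≡ n
        r′i≡ = updateAt-updates i r

        n<ri : n < r i
        n<ri = ℕ.≤-reflexive (sym ri≡)

        n<h : n < h i
        n<h = ℕ.≤-trans n<ri (r≤h i)

      lowered-≤ : ∀ i′ → r′ i′ ≤ r i′
      lowered-≤ i′ with i′ ≟ i
      ... | yes refl = ℕ.≤-trans (ℕ.≤-reflexive r′i≡) (ℕ.<⇒≤ n<ri)
      ... | no  i′≢i = ℕ.≤-reflexive (updateAt-minimal i′ i r i′≢i)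

      private
        vertexY : ∃ (at i (suc (n * 2)))
        vertexY = At-vertex A x y h i _ (s≤s (ℕ.<⇒≤ (ℕ.<-trans (ℕ.n<1+n _) (<⇒suc*2< n<h))))

        vertexZ : ∃ (at i (suc n * 2))
        vertexZ = At-vertex A x y h i _ (s≤s (ℕ.<⇒≤ (<⇒suc*2< n<h)))

        y′ z : W
        y′ = proj₁ vertexY
        z  = proj₁ vertexZ

        at-y′ : at i (suc (n * 2)) y′
        at-y′ = proj₂ vertexY

        at-z : at i (suc n * 2) z
        at-z = proj₂ vertexZ

        y′∉ : ¬ In y′
        y′∉ = odd∉ n at-y′

        z∈ : In z
        z∈ = even∈ (suc n) at-z

        ≢y′ : ∀ {i′} q {a} → q < r′ i′ → at i′ (suc (q * 2)) a → a ≢ y′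
        ≢y′ q q< s refl with odd-unique q n s at-y′
        ... | inj₁ (refl , refl)  = ℕ.<-irrefl (sym r′i≡) q<
        ... | inj₂ (_ , _ , n≡h) = ℕ.<⇒≢ n<h n≡h

        remains : ∀ {a} → Remaining r′ a → Remaining r a × a ≢ y′
        remains root          = root , λ eq → y′∉ (subst In eq (old x∈X))
        remains (odd q q< s)  = odd q (ℕ.≤-trans q< (lowered-≤ _)) s , ≢y′ q q< s
        remains (even q q< s) = even q (ℕ.≤-trans q< (lowered-≤ _)) s ,
          λ eq → y′∉ (subst In eq (even∈ (suc q) s))

        disjoint : ∀ {a} → a ≡ z → ¬ Remaining r′ a
        disjoint eq   root          = even-inner n (subst (at i (suc n * 2)) (sym eq) at-z)
        disjoint refl (odd q _ s)   = odd∉ q s z∈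
        disjoint refl (even q q< s) with even-unique q n s at-z
        ... | refl , refl = ℕ.<-irrefl (sym r′i≡) q<

        z-neighbours : ∀ {b} → z ~ b → Claimed r b ⊎ b ≡ y′
        z-neighbours zb with even-neighbours n at-z zb
        ... | inj₁ t = inj₂ (At-functional A x y h t at-y′ refl)
        ... | inj₂ t = inj₁ (passed (suc n) (ℕ.≤-reflexive ri≡) t)

        claimed : ∀ {a} → Claimed r′ a → Claimed r a ⊎ a ≡ y′
        claimed (neighbour xu) = inj₁ (neighbour xu)
        claimed (passed {i′} q r′≤q s) with i′ ≟ i
        ... | no  i′≢i = inj₁ (passed q (subst (_≤ q) (updateAt-minimal i′ i r i′≢i) r′≤q) s)
        ... | yes refl with ℕ.m≤n⇒m<n∨m≡n (subst (_≤ q) r′i≡ r′≤q)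
        ...   | inj₁ n<q  = inj₁ (passed q (subst (_≤ q) (sym ri≡) n<q) s)
        ...   | inj₂ refl = inj₂ (At-functional A x y h s at-y′ refl)

      -- Claiming y′ forces Dominator to answer z, the remaining vertex of N[z].
      force : Goal r′ → Goal r
      force rest = node {L = _≡ z} {R = Remaining r′} (odd n n<ri at-y′) (_≟ᵂ z)
        (λ { refl → even n n<ri at-z , λ eq → y′∉ (subst In eq z∈) })
        remains disjoint (leaf refl z∈ z-neighbours) (Elimination-mono claimed id rest)

    -- The pairs of path `i` are forced one after another, the one nearest to `y` first. The
    -- continuation `done` receives the lowered counters through their values only.
    drain : ∀ n {r} i → (∀ i → r i ≤ h i) → r i ≡ n →
            (∀ r′ → (∀ i → r′ i ≤ h i) → r′ i ≡ 0 → (∀ {i′} → i′ ≢ i → r′ i′ ≡ r i′) → Goal r′) →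
            Goal r
    drain zero    i r≤h eq done = done _ r≤h eq (λ _ → refl)
    drain (suc n) {r} i r≤h eq done = force r≤h eq
      (drain n i (λ i′ → ℕ.≤-trans (lowered-≤ r≤h eq i′) (r≤h i′)) (updateAt-updates i r)
        λ r′ r′≤h eq′ same → done r′ r′≤h eq′
          (λ i′≢i → trans (same i′≢i) (updateAt-minimal _ i r i′≢i)))

    -- The neighbours of `x` are its surviving old neighbours and the vertices at position 1, and
    -- the latter are all claimed once no pair remains.
    x-leaf : ∀ {r} → (∀ i → r i ≡ 0) → Goal r
    x-leaf {r} r≡0 = leaf root (old x∈X) (λ xb → neighbours xb refl)
      where
      neighbours : ∀ {a b} → a ~ b → a ≡ inj₁ x → Claimed r b
      neighbours (kept xu _ _) refl = neighbour xu
      neighbours (forward {i} s t) eq with At-old A x y h s eq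
      ... | inj₁ (_ , refl) = passed 0 (ℕ.≤-reflexive (r≡0 i)) t
      ... | inj₂ (x≡y , _)  = contradiction x≡y x≢y
      neighbours (backward s t) eq with At-old A x y h t eq
      ... | inj₂ (x≡y , _)  = contradiction x≡y x≢y

    drain-all : ∀ c {r} → c ≤ k → (∀ i → r i ≤ h i) → (∀ i → c ≤ toℕ i → r i ≡ 0) → Goal r
    drain-all zero    _   _   r≡0 = x-leaf (λ i → r≡0 i z≤n)
    drain-all (suc c) {r} c<k r≤h r≡0 = drain _ (fromℕ< c<k) r≤h refl
      λ r′ r′≤h eq same → drain-all c (ℕ.<⇒≤ c<k) r′≤h (drained r′ eq same)
      where
      drained : ∀ r′ → r′ (fromℕ< c<k) ≡ 0 → (∀ {i} → i ≢ fromℕ< c<k → r′ i ≡ r i) →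
                ∀ i → c ≤ toℕ i → r′ i ≡ 0
      drained r′ eq same i c≤i with i ≟ fromℕ< c<k
      ... | yes refl = eq
      ... | no  i≢c  = trans (same i≢c) (r≡0 i (ℕ.≤∧≢⇒< c≤i
        λ c≡i → i≢c (toℕ-injective (trans (sym c≡i) (sym (toℕ-fromℕ< c<k))))))

    caterpillar : Goal h
    caterpillar = drain-all k ℕ.≤-refl (λ _ → ℕ.≤-refl)
      λ i k≤i → contradiction (toℕ<n i) (ℕ.≤⇒≯ k≤i)

    -- Inner vertices follow `x`: the branch of the old tree that may use `x` receives all of them,
    -- and preimages of disjoint parts stay disjoint.
    retract : W → V A
    retract (inj₁ u) = u
    retract (inj₂ _) = x

    data Old (P : V A → Set) : W → Set where
      isOld : ∀ {u} → P u → Old P (inj₁ u)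

    -- The old tree keeps its shape above the leaves. A leaf other than `x` lies in `X`, so it is
    -- not `y` either, and it gains no neighbour on the new paths.
    extend : ∀ {P F : V A → Set} → Elimination (Adj A) (_∈ X) P F →
             Elimination _~_ In (Old P) (F ∘ retract)
    extend {P} {F} (node {y′} Fy L? L⊆ R⊆ LR l r) = node {y = inj₁ y′} Fy (L? ∘ retract)
        (λ La → proj₁ (L⊆ La) , λ { refl → proj₂ (L⊆ La) refl })
        (λ Ra → proj₁ (R⊆ Ra) , λ { refl → proj₂ (R⊆ Ra) refl })
        LR (Elimination-mono claimed id (extend l)) (Elimination-mono claimed id (extend r))
      where
      claimed : ∀ {a} → Old (λ a → P a ⊎ a ≡ y′) a → Old P a ⊎ a ≡ inj₁ y′
      claimed (isOld (inj₁ Pu))   = inj₁ (isOld Pu)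
      claimed (isOld (inj₂ refl)) = inj₂ refl
    extend {P} {F} (leaf {x′} Fx x′∈X N) with x′ ≟ x
    ... | no x′≢x = leaf {x = inj₁ x′} Fx (old x′∈X) (λ xb → neighbours xb refl)
      where
      notOnPath : ∀ {i p a} → at i p a → a ≢ inj₁ x′
      notOnPath s eq with At-old A x y h s eq
      ... | inj₁ (x′≡x , _) = x′≢x x′≡x
      ... | inj₂ (refl , _) = y∉X x′∈X
      neighbours : ∀ {a b} → a ~ b → a ≡ inj₁ x′ → Old P b
      neighbours (kept xu _ _)  refl = isOld (N xu)
      neighbours (forward s _)  eq   = contradiction eq (notOnPath s)
      neighbours (backward _ t) eq   = contradiction eq (notOnPath t)
    -- All old neighbours of the leaf `x` are ancestors, in particular `y`, the claimed end from
    -- which the caterpillar starts.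
    ... | yes refl = Elimination-mono claimed free caterpillar
      where
      claimed : ∀ {a} → Claimed h a → Old P a
      claimed (neighbour xu) = isOld (N xu)
      claimed {inj₁ u} (passed q _ s) with odd-old q s
      ... | refl , _ = isOld (N xy)
      claimed {inj₂ (i , j)} (passed q h≤q s) with At-inner A x y h s refl
      ... | refl , eq = contradiction
        (ℕ.≤-trans (toℕ<n j) (ℕ.≤-trans (ℕ.≤-reflexive (ℕ.*-comm 2 (h i))) (ℕ.*-monoˡ-≤ 2 h≤q)))
        (ℕ.<-irrefl (sym (ℕ.suc-injective eq)))
      free : ∀ {a} → Remaining h a → F (retract a)
      free root                   = Fx
      free {inj₁ _} (odd q q<h s) = contradiction (proj₂ (odd-old q s)) (ℕ.<⇒≢ q<h)
      free {inj₁ _} (even q _ s)  = contradiction s (even-inner q)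
      free {inj₂ _} _             = Fx

  replacement-certificate : Certificate (ReplacementAdj A x y h) In
  replacement-certificate = record
    { bipartite   = bipartite
    ; noIsolated  = noIsolated
    ; matching    = matching
    ; elimination = Elimination-mono nothing-old id (extend C.elimination)
    }
    where
    nothing-old : ∀ {a} → Old (λ _ → ⊥) a → ⊥
    nothing-old (isOld ())

module _ {A : Graph} {X : Subset (order A)} {A′ : Graph} {X′ : Subset (order A′)}
         (C : Certificate (Adj A) (_∈ X)) where

  private
    oriented : ∀ {x y} → Adj A x y → x ∈ X → ∀ {k} (h : Fin k → ℕ) → Fin k →
               (realises : Realises A′ (ReplacementAdj A x y h)) → IsBipartitionClass A′ X′ →
               (∀ {v} → v ∈ X → Realises.from realises (inj₁ v) ∈ X′) →
               Certificate (Adj A′) (_∈ X′)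
    oriented xy x∈X h i₀ realises class old⊆ = Certificate-realise realises
      (λ a → mk⇔ (subst (_∈ X′) (sym (from∘to a))) (subst (_∈ X′) (from∘to a)))
      (replacement-certificate C xy x∈X h i₀ {In = λ w → from w ∈ X′} (class ∘ ~⇒Adj) old⊆)
      where
      open Realises realises
      from∘to : ∀ a → from (to a) ≡ a
      from∘to = Inverse.strictlyInverseʳ bijection
      ~⇒Adj : ∀ {v w} → ReplacementAdj A _ _ h v w → Adj A′ (from v) (from w)
      ~⇒Adj vw = Equivalence.from (adjacency _ _)
        (subst₂ (ReplacementAdj A _ _ h) (sym (Inverse.strictlyInverseˡ bijection _))
          (sym (Inverse.strictlyInverseˡ bijection _)) vw)

  -- One end of the replaced edge lies in `X`; if it is `y`, all paths are reversed and the two ends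
  -- exchange roles.
  replaced⇒certificate : (r : OddReplacement A A′) → IsBipartitionClass A′ X′ →
    (∀ {v} → v ∈ X → OddReplacement.old r v ∈ X′) → Certificate (Adj A′) (_∈ X′)
  replaced⇒certificate r class old⊆ with Certificate.bipartite C (OddReplacement.edge r)
  -- `2≤k` also reads as `1 < k`, so the path with index 1 is taken as `i₀`.
  ... | inj₁ (x∈X , _) = oriented edge x∈X h (fromℕ< 2≤k) realises class old⊆
    where open OddReplacement r
  ... | inj₂ (_ , y∈X) =
    oriented (Adj-sym A edge) y∈X h (fromℕ< 2≤k) (reversePaths-realises realises) class old⊆
    where open OddReplacement r

𝒜⇒certificate : ∀ {A X} → 𝒜 A X → Certificate (Adj A) (_∈ X)
𝒜⇒certificate (subdivided s)              = subdivided⇒certificate s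
𝒜⇒certificate (replaced A∈𝒜 r class old⊆) =
  replaced⇒certificate (𝒜⇒certificate A∈𝒜) r class old⊆

theorem6p2 : (A : Graph) (X : Subset (order A)) → 𝒜 A X → AtomicMBDCritical A (∁ X)
theorem6p2 A X A∈𝒜 = certificate⇒critical (𝒜⇒certificate A∈𝒜)
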